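{- Let $\mathbb{F}$ be any field. The graph isomorphism problem Karp-reduces (in polynomial time) to the code equivalence problem over $\mathbb{F}$.
   Context: A code of length $n$ over $\mathbb{F}$ is a linear subspace of $\mathbb{F}^n$, given by a basis. The symmetric group $S_n$ acts on $\mathbb{F}^n$ by $\pi\cdot(\alpha_1,\dots,\alpha_n)=(\alpha_{\pi(1)},\dots,\alpha_{\pi(n)})$, and on subspaces by $\pi\cdot V=\{\pi\cdot v: v\in V\}$. Code equivalence problem: given two codes $C_1,C_2\subseteq\mathbb{F}^n$, determine whether there is $\pi\in S_n$ with $\pi\cdot C_1=C_2$. Graph isomorphism: given two finite graphs, decide whether they are isomorphic. -}

module Defs where

open import Level using (Level; _⊔_) renaming (suc to lsuc; zero to lzero)
open import Algebra.Bundles using (CommutativeRing)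
open import Algebra.Definitions using (Invertible)
open import Data.Bool.Base using (Bool; true; false)
open import Data.Fin.Base using (Fin)
open import Data.Fin.Permutation using (Permutation; Permutation′; _⟨$⟩ʳ_)
open import Data.List.Base as List using (List; []; _∷_; _++_; length; fromMaybe)
open import Data.Maybe.Base using (Maybe; just; nothing)
open import Data.Nat.Base as ℕ using (ℕ; suc; _^_; _≤_)
open import Data.Product.Base using (∃-syntax; _×_; _,_)
open import Data.Sum.Base using (_⊎_; inj₁; inj₂)
open import Data.Vec.Base as Vec using (Vec)
open import Data.Vec.Functional using (Vector)
open import Function.Bundles using (_⇔_; _↔_)
open import Relation.Binary.PropositionalEquality.Core using (_≡_)
open import Relation.Nullary.Negation.Core using (¬_)

------------------------------------------------------------------------
-- Fields

-- Equality is not assumed decidable.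

record Field c ℓ : Set (lsuc (c ⊔ ℓ)) where
  field
    commutativeRing : CommutativeRing c ℓ

  open CommutativeRing commutativeRing public

  field
    0≉1        : ¬ (0# ≈ 1#)
    invertible : ∀ x → ¬ (x ≈ 0#) → Invertible _≈_ 1# _*_ x

------------------------------------------------------------------------
-- Deterministic Turing machines with a two-way read-only input tape, a
-- fixed number of two-way infinite work tapes, and a write-only output
-- tape.

Finite : Set → Set
Finite A = ∃[ n ] (A ↔ Fin n)

data Move : Set where
  leftward stay rightward : Move

-- `lefts` lists the cells left of the head, nearest first; all cells
-- beyond the two lists are blank.

record Tape (A : Set) : Set where
  constructor tape
  field
    lefts  : List A
    here   : A
    rights : List A

open Tape public

module _ {A : Set} (blank : A) where

  fromWord : List A → Tape A
  fromWord []       = tape [] blank []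
  fromWord (x ∷ xs) = tape [] x xs

  shift : Move → Tape A → Tape A
  shift stay      t                       = t
  shift leftward  (tape []       x rs)    = tape [] blank (x ∷ rs)
  shift leftward  (tape (l ∷ ls) x rs)    = tape ls l (x ∷ rs)
  shift rightward (tape ls x [])          = tape (x ∷ ls) blank []
  shift rightward (tape ls x (r ∷ rs))    = tape (x ∷ ls) r rs

write : {A : Set} → A → Tape A → Tape A
write a (tape ls _ rs) = tape ls a rs

-- The output alphabet O may be infinite, but δ has finitely many
-- arguments, so a given machine uses only finitely many letters of O.
-- Replacing those letters by code words over a finite alphabet therefore
-- changes running times by at most a constant factor.

module _ {o : Level} (O : Set o) where

  record Action (Q Γ : Set) (k : ℕ) : Set o where
    constructor action
    field
      next      : Q
      inputMove : Move
      workMoves : Vec (Γ × Move) k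
      emit      : Maybe O

  record TuringMachine : Set (lsuc lzero ⊔ o) where
    field
      Q        : Set
      Q-finite : Finite Q
      start    : Q
      Γ        : Set
      Γ-finite : Finite Γ
      blank    : Γ
      k        : ℕ
      -- The input symbol is `nothing` outside the input word; the result
      -- `nothing` means that the machine halts.
      δ        : Q → Maybe Bool → Vec Γ k → Maybe (Action Q Γ k)

module Execution {o : Level} {O : Set o} (M : TuringMachine O) where
  open TuringMachine M

  record Configuration : Set o where
    constructor configuration
    field
      state  : Q
      input  : Tape (Maybe Bool)
      work   : Vec (Tape Γ) k
      output : List O

  open Configuration public

  initial : List Bool → Configuration
  initial w = configuration start (fromWord nothing (List.map just w))
                (Vec.replicate k (fromWord blank [])) []

  act : Action O Q Γ k → Configuration → Configuration
  act (action q m ms e) (configuration _ inp ts out) = configuration q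
    (shift nothing m inp)
    (Vec.zipWith (λ (γ , d) t → shift blank d (write γ t)) ms ts)
    (out ++ fromMaybe e)

  δ-at : Configuration → Maybe (Action O Q Γ k)
  δ-at c = δ (state c) (here (input c)) (Vec.map here (work c))

  -- c ⇓[ t ] w : from c the machine halts after exactly t steps with the
  -- word w on its output tape.

  data _⇓[_]_ : Configuration → ℕ → List O → Set o where
    halt : ∀ {c} → δ-at c ≡ nothing → c ⇓[ 0 ] output c
    step : ∀ {c a t w} → δ-at c ≡ just a → act a c ⇓[ t ] w → c ⇓[ suc t ] w

------------------------------------------------------------------------
-- Decision problems and Karp reductions

record Problem {a} (A : Set a) (i p : Level) : Set (a ⊔ lsuc (i ⊔ p)) where
  field
    Instance : Set i
    encode   : Instance → List A
    Yes      : Instance → Set p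

-- f maps words u x to words v (f x) in time polynomial in the length of
-- the input word.  Nothing is required of the machine on words that do not
-- encode an instance.

PolynomialTime : ∀ {i j o} {X : Set i} {Y : Set j} {O : Set o} →
                 (X → List Bool) → (Y → List O) → (X → Y) →
                 Set (lsuc lzero ⊔ i ⊔ o)
PolynomialTime {O = O} u v f =
  ∃[ M ] let open Execution {O = O} M in
  ∃[ c ] ∃[ d ] ∀ x →
  ∃[ t ] t ≤ c ℕ.* suc (length (u x)) ^ d × initial (u x) ⇓[ t ] v (f x)

record _≤ₚ_ {o i j p q} {O : Set o} (A : Problem Bool i p) (B : Problem O j q) :
            Set (lsuc lzero ⊔ o ⊔ i ⊔ j ⊔ p ⊔ q) where
  private
    module A = Problem A
    module B = Problem B
  field
    reduce         : A.Instance → B.Instance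
    correct        : ∀ x → A.Yes x ⇔ B.Yes (reduce x)
    polynomialTime : PolynomialTime A.encode B.encode reduce

unary : ℕ → List Bool
unary n = List.replicate n true ++ false ∷ []

rowMajor : ∀ {a} {A : Set a} {m n} → (Fin m → Fin n → A) → List A
rowMajor M = List.concat (List.tabulate (λ i → List.tabulate (M i)))

------------------------------------------------------------------------
-- Graph isomorphism

record Graph : Set where
  field
    order       : ℕ
    adjacent    : Fin order → Fin order → Bool
    symmetric   : ∀ i j → adjacent i j ≡ adjacent j i
    irreflexive : ∀ i → adjacent i i ≡ false

_≅_ : Graph → Graph → Set
G ≅ H = ∃[ π ] ∀ i j → G.adjacent i j ≡ H.adjacent (π ⟨$⟩ʳ i) (π ⟨$⟩ʳ j)
  where
  module G = Graph G
  module H = Graph H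

encodeGraph : Graph → List Bool
encodeGraph G = unary order ++ rowMajor adjacent
  where open Graph G

GraphIsomorphism : Problem Bool lzero lzero
GraphIsomorphism = record
  { Instance = Graph × Graph
  ; encode   = λ (G , H) → encodeGraph G ++ encodeGraph H
  ; Yes      = λ (G , H) → G ≅ H
  }

------------------------------------------------------------------------
-- Code equivalence

module _ {c ℓ} (F : Field c ℓ) where
  private
    module F = Field F
  open F using (Carrier; _≈_; 0#; commutativeRing)
  open CommutativeRing commutativeRing using (semiring)
  open import Algebra.Properties.Semiring.Sum semiring using (sum)

  combination : ∀ {k n} → Vector Carrier k → (Fin k → Vector Carrier n) →
                Vector Carrier n
  combination a b j = sum (λ i → a i F.* b i j)

  record Code (n : ℕ) : Set (c ⊔ ℓ) where
    field
      dimension   : ℕ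
      basis       : Fin dimension → Vector Carrier n
      independent : ∀ (a : Vector Carrier dimension) →
                    (∀ j → combination a basis j ≈ 0#) → ∀ i → a i ≈ 0#

  _∈ᶜ_ : ∀ {n} → Vector Carrier n → Code n → Set (c ⊔ ℓ)
  v ∈ᶜ C = ∃[ a ] ∀ j → v j ≈ combination a (Code.basis C) j

  _·_ : ∀ {n} → Permutation′ n → Vector Carrier n → Vector Carrier n
  (π · v) j = v (π ⟨$⟩ʳ j)

  _∈[_·_] : ∀ {n} → Vector Carrier n → Permutation′ n → Code n → Set (c ⊔ ℓ)
  v ∈[ π · C ] = ∃[ u ] u ∈ᶜ C × (∀ j → v j ≈ (π · u) j)

  Equivalent : ∀ {n} → Code n → Code n → Set (c ⊔ ℓ)
  Equivalent C₁ C₂ = ∃[ π ] ∀ v → v ∈[ π · C₁ ] ⇔ v ∈ᶜ C₂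

  record CodePair : Set (c ⊔ ℓ) where
    constructor codePair
    field
      blocklength : ℕ
      C₁ C₂       : Code blocklength

  -- Numbers are written in unary with bits; each field element is one
  -- letter.

  encodeCode : ∀ {n} → Code n → List (Bool ⊎ Carrier)
  encodeCode C = List.map inj₁ (unary dimension) ++ List.map inj₂ (rowMajor basis)
    where open Code C

  CodeEquivalence : Problem (Bool ⊎ Carrier) (c ⊔ ℓ) (c ⊔ ℓ)
  CodeEquivalence = record
    { Instance = CodePair
    ; encode   = λ (codePair n C₁ C₂) →
        List.map inj₁ (unary n) ++ encodeCode C₁ ++ encodeCode C₂
    ; Yes      = λ (codePair _ C₁ C₂) → Equivalent C₁ C₂
    }

-- A graph on n vertices becomes a code of dimension n whose columns are
-- indexed by pairs of vertices: the column at (i , i) is the unit vector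
-- e_i, the column at (i , j) is e_i + e_j if i and j are adjacent, and all
-- other columns are zero.  By symmetry a column e_i + e_j occurs twice, so
-- unit vectors are the nonzero columns of multiplicity one.  A column
-- permutation that carries one code to the other comes with linear maps in
-- both directions between corresponding columns; it therefore matches unit
-- vectors with unit vectors, and e_i + e_j shows which of these come from
-- adjacent vertices.  The codes of G and H live on disjoint blocks of columns,
-- which makes sense for graphs of different orders as well.
--
-- Row v has at (i , j) the majority of the truth values "i and j are
-- adjacent", "i = v" and "j = v".  A Turing machine prints the rows by running
-- two heads over work tapes of n cells, of which the v-th is marked, while a
-- third head reads the adjacency matrix.

module Submission where

open import Data.Bool.Base using (Bool; true; false; if_then_else_; _∧_; _∨_)
open import Data.Bool.Properties using (∨-comm; ∧-comm; T-≡; ⇔→≡)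
open import Data.Fin.Base using (Fin; zero; suc; toℕ; combine; _↑ˡ_; _↑ʳ_; punchIn)
open import Data.Fin.Patterns using (0F; 1F; 2F; 3F; 4F)
open import Data.Fin.Permutation
  using (Permutation; Permutation′; permutation; _⟨$⟩ʳ_; _⟨$⟩ˡ_; inverseˡ; inverseʳ)
open import Data.Fin.Properties using (_≟_; toℕ-injective; 1↔⊤; +↔⊎; *↔×; punchInᵢ≢i)
open import Data.List.Base as List using (List; []; _∷_; _++_; _ʳ++_; length)
open import Data.List.Properties
  using (++-assoc; ++-identityʳ; ++-ʳ++; ʳ++-ʳ++; length-++-≤ˡ; length-++-≤ʳ; length-ʳ++;
         length-replicate; length-tabulate; map-++; map-replicate; map-tabulate; concat-map; tabulate-cong)
open import Data.Maybe.Base using (Maybe; just; nothing; is-just; fromMaybe)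
open import Data.Nat.Base using (ℕ; zero; suc; _+_; _*_; _^_; _≤_; z≤n; s≤s; _≡ᵇ_)
open import Data.Nat.Properties as ℕ using (≡ᵇ⇒≡; ≡⇒≡ᵇ; module ≤-Reasoning)
open import Data.Product.Base as Product using (∃-syntax; Σ-syntax; _×_; _,_; proj₁; proj₂)
open import Data.Product.Function.NonDependent.Propositional using (_×-↔_)
open import Data.Sum.Base as Sum using (_⊎_; inj₁; inj₂; [_,_]′)
open import Data.Sum.Function.Propositional using (_⊎-↔_)
open import Data.Sum.Properties using (inj₁-injective)
open import Data.Unit.Base using (⊤; tt)
open import Data.Vec.Base as Vec using (Vec; []; _∷_; lookup; updateAt)
open import Data.Vec.Properties using (lookup-map)
open import Function.Base using (_∘_; const)
open import Function.Bundles using (_↔_; mk↔ₛ′; mk⇔; Inverse; Equivalence)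
open import Function.Properties.Inverse using (↔-sym; ↔-trans)
open import Function.Related.TypeIsomorphisms using (⊎-comm)
open import Level using (_⊔_)
open import Relation.Binary.PropositionalEquality
  using (_≡_; _≢_; refl; sym; trans; cong; cong₂; subst; module ≡-Reasoning)
open import Relation.Nullary.Decidable.Core using (yes; no)
open import Relation.Nullary.Negation.Core using (¬_; contradiction)

open import Defs

-- Structured programs and their compilation to Turing machines

-- Work tapes share the alphabet of the input tape, with `nothing` as the blank, so that programs
-- treat all tapes alike.
Symbol : Set
Symbol = Maybe Bool

Symbol-finite : Finite Symbol
Symbol-finite = 3 , mk↔ₛ′
  (λ { nothing → zero ; (just false) → suc zero ; (just true) → suc (suc zero) })
  (λ { zero → nothing ; (suc zero) → just false ; (suc (suc zero)) → just true })
  (λ { zero → refl ; (suc zero) → refl ; (suc (suc zero)) → refl })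
  (λ { nothing → refl ; (just false) → refl ; (just true) → refl })

⊤-finite : Finite ⊤
⊤-finite = 1 , ↔-sym 1↔⊤

⊎-finite : ∀ {A B} → Finite A → Finite B → Finite (A ⊎ B)
⊎-finite (m , A↔m) (n , B↔n) = m + n , ↔-trans (A↔m ⊎-↔ B↔n) (↔-sym +↔⊎)

Tapes : ℕ → Set
Tapes k = Vec (Tape Symbol) (suc k)

-- A transition has to write on every work tape; writing back the scanned symbol without moving
-- leaves a tape as it is.
still : ∀ {n} → Vec Symbol n → Vec (Symbol × Move) n
still = Vec.map (_, stay)

perform : ∀ {n} → Vec (Symbol × Move) n → Vec (Tape Symbol) n → Vec (Tape Symbol) n
perform = Vec.zipWith (λ (γ , d) t → shift nothing d (write γ t))

perform-still : ∀ {n} (ts : Vec (Tape Symbol) n) → perform (still (Vec.map here ts)) ts ≡ ts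
perform-still []       = refl
perform-still (t ∷ ts) = cong (t ∷_) (perform-still ts)

perform-updateAt : ∀ {n} (ts : Vec (Tape Symbol) n) j {f g} →
                   (∀ t → shift nothing (proj₂ (f (here t , stay)))
                            (write (proj₁ (f (here t , stay))) t) ≡ g t) →
                   perform (updateAt (still (Vec.map here ts)) j f) ts ≡ updateAt ts j g
perform-updateAt (t ∷ ts) zero    eq = cong₂ _∷_ (eq t) (perform-still ts)
perform-updateAt (t ∷ ts) (suc j) eq = cong (t ∷_) (perform-updateAt ts j eq)

-- Structured programs on an input tape (tape zero) and k work tapes.

module _ {o} (O : Set o) (k : ℕ) where

  infixr 5 _⨾_

  -- Only work tapes can be written on, hence the smaller index type of `put`; heads move and loops
  -- test on all tapes.
  data Program : Set o where
    move  : Fin (suc k) → Move → Program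
    put   : Fin k → Symbol → Program
    emit  : (Vec Symbol (suc k) → O) → Program
    _⨾_   : Program → Program → Program
    while : Fin (suc k) → (Symbol → Bool) → Program → Program

module _ {o} {O : Set o} {k : ℕ} where

  module Semantics (N : ℕ) where

    infix 4 _⊢_⇓_∣_

    -- Every execution of a loop makes at most N iterations, so the syntax
    -- of a program bounds its running time by a polynomial in N.

    mutual

      data _⊢_⇓_∣_ : Program O k → Tapes k → Tapes k → List O → Set o where
        -- The resulting tapes are given by an equation, so that a run can present them in any equal
        -- form.
        move  : ∀ {i d ts ts′} → updateAt ts i (shift nothing d) ≡ ts′ →
                move i d ⊢ ts ⇓ ts′ ∣ []
        put   : ∀ {j γ ts ts′} → updateAt ts (suc j) (write γ) ≡ ts′ →
                put j γ ⊢ ts ⇓ ts′ ∣ []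
        emit  : ∀ {f ts a} → f (Vec.map here ts) ≡ a →
                emit f ⊢ ts ⇓ ts ∣ a ∷ []
        _⨾_   : ∀ {P R ts ts′ ts″ v w} → P ⊢ ts ⇓ ts′ ∣ v → R ⊢ ts′ ⇓ ts″ ∣ w →
                P ⨾ R ⊢ ts ⇓ ts″ ∣ v ++ w
        while : ∀ {i c P n ts ts′ w} → n ≤ N → Iterations i c P n ts ts′ w →
                while i c P ⊢ ts ⇓ ts′ ∣ w

      data Iterations (i : Fin (suc k)) (c : Symbol → Bool) (P : Program O k) :
                      ℕ → Tapes k → Tapes k → List O → Set o where
        stop  : ∀ {ts} → c (here (lookup ts i)) ≡ false →
                Iterations i c P 0 ts ts []
        again : ∀ {n ts ts′ ts″ v w} → c (here (lookup ts i)) ≡ true →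
                P ⊢ ts ⇓ ts′ ∣ v → Iterations i c P n ts′ ts″ w →
                Iterations i c P (suc n) ts ts″ (v ++ w)

  -- Polynomial time bounds

  bound : ℕ → Program O k → ℕ
  bound N (move _ _)    = 1
  bound N (put _ _)     = 1
  bound N (emit _)      = 1
  bound N (P ⨾ R)       = bound N P + bound N R
  -- At most `N` successful tests, each with a pass through the body, and one test that fails.
  bound N (while _ _ P) = suc (N * suc (bound N P))

  -- By induction on the syntax: composition adds coefficients and exponents, and a loop raises the
  -- exponent by one. The base `suc N` keeps all powers positive, so that single extra steps are
  -- absorbed by the coefficient.
  bound-polynomial : ∀ P → ∃[ c ] ∃[ d ] ∀ N → bound N P ≤ c * suc N ^ d
  bound-polynomial (move _ _) = 1 , 0 , λ _ → ℕ.≤-refl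
  bound-polynomial (put _ _)  = 1 , 0 , λ _ → ℕ.≤-refl
  bound-polynomial (emit _)   = 1 , 0 , λ _ → ℕ.≤-refl
  bound-polynomial (P ⨾ R)
    with c , d , p ← bound-polynomial P | c′ , d′ , r ← bound-polynomial R
    = c + c′ , d + d′ , λ N → begin
        bound N P + bound N R
          ≤⟨ ℕ.+-mono-≤ (p N) (r N) ⟩
        c * suc N ^ d + c′ * suc N ^ d′
          ≤⟨ ℕ.+-mono-≤ (ℕ.*-monoʳ-≤ c (ℕ.^-monoʳ-≤ (suc N) (ℕ.m≤m+n d d′)))
                        (ℕ.*-monoʳ-≤ c′ (ℕ.^-monoʳ-≤ (suc N) (ℕ.m≤n+m d′ d))) ⟩
        c * suc N ^ (d + d′) + c′ * suc N ^ (d + d′)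
          ≡⟨ ℕ.*-distribʳ-+ (suc N ^ (d + d′)) c c′ ⟨
        (c + c′) * suc N ^ (d + d′) ∎
    where open ≤-Reasoning
  bound-polynomial (while _ _ P) with c , d , p ← bound-polynomial P
    = suc c , suc d , λ N → begin
        suc (N * suc (bound N P))
          ≤⟨ s≤s (ℕ.m≤n+m _ (bound N P)) ⟩
        suc N * suc (bound N P)
          ≤⟨ ℕ.*-monoʳ-≤ (suc N) (ℕ.+-mono-≤ (ℕ.m^n>0 (suc N) d) (p N)) ⟩
        suc N * (suc c * suc N ^ d)
          ≡⟨ ℕ.*-assoc (suc N) (suc c) _ ⟨
        suc N * suc c * suc N ^ d
          ≡⟨ cong (_* suc N ^ d) (ℕ.*-comm (suc N) (suc c)) ⟩
        suc c * suc N * suc N ^ d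
          ≡⟨ ℕ.*-assoc (suc c) (suc N) _ ⟩
        suc c * suc N ^ suc d ∎
    where open ≤-Reasoning

  -- Compilation of programs

  Position : Program O k → Set
  Position (move _ _)    = ⊤
  Position (put _ _)     = ⊤
  Position (emit _)      = ⊤
  Position (P ⨾ R)       = Position P ⊎ Position R
  -- The additional position is the test of the loop, to which the body returns.
  Position (while _ _ P) = ⊤ ⊎ Position P

  Position-finite : ∀ P → Finite (Position P)
  Position-finite (move _ _)    = ⊤-finite
  Position-finite (put _ _)     = ⊤-finite
  Position-finite (emit _)      = ⊤-finite
  Position-finite (P ⨾ R)       = ⊎-finite (Position-finite P) (Position-finite R)
  Position-finite (while _ _ P) = ⊎-finite ⊤-finite (Position-finite P)

  entry : ∀ P → Position P
  entry (move _ _)    = tt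
  entry (put _ _)     = tt
  entry (emit _)      = tt
  entry (P ⨾ R)       = inj₁ (entry P)
  entry (while _ _ P) = inj₁ tt

  -- The transitions of P inside a machine with states Q, where ι embeds
  -- the positions of P and x is the state that follows P.

  transition : ∀ {Q : Set} P → (Position P → Q) → Q → Position P →
               Symbol → Vec Symbol k → Action O Q Symbol k
  transition (move zero d)    ι x _ γ γs = action x d (still γs) nothing
  transition (move (suc j) d) ι x _ γ γs =
    action x stay (updateAt (still γs) j (λ (γ′ , _) → γ′ , d)) nothing
  transition (put j γ′)       ι x _ γ γs =
    action x stay (updateAt (still γs) j (const (γ′ , stay))) nothing
  transition (emit f)         ι x _ γ γs = action x stay (still γs) (just (f (γ ∷ γs)))
  transition (P ⨾ R) ι x (inj₁ p) = transition P (ι ∘ inj₁) (ι (inj₂ (entry R))) p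
  transition (P ⨾ R) ι x (inj₂ p) = transition R (ι ∘ inj₂) x p
  transition (while i c P) ι x (inj₁ _) γ γs = action
    (if c (lookup (γ ∷ γs) i) then ι (inj₂ (entry P)) else x) stay (still γs) nothing
  transition (while i c P) ι x (inj₂ p) = transition P (ι ∘ inj₂) (ι (inj₁ tt)) p

  -- The state `inj₁ tt` added to the positions is the halting state, which follows the whole
  -- program.
  machine : Program O k → TuringMachine O
  machine P = record
    { Q        = ⊤ ⊎ Position P
    ; Q-finite = ⊎-finite ⊤-finite (Position-finite P)
    ; start    = inj₂ (entry P)
    ; Γ        = Symbol
    ; Γ-finite = Symbol-finite
    ; blank    = nothing
    ; k        = k
    ; δ        = λ { (inj₁ _) _ _ → nothing
                   ; (inj₂ p) γ γs → just (transition P inj₂ (inj₁ tt) p γ γs) }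
    }

  module _ (P₀ : Program O k) (N : ℕ) where
    open Execution (machine P₀)
    open Semantics N
    open TuringMachine (machine P₀) using (Q; δ)

    configure : Q → Tapes k → List O → Configuration
    configure q (t ∷ ts) out = configuration q t ts out

    -- The machine of `P₀` stays fixed while the simulation descends to subprograms, whose positions
    -- are found inside it along ι.
    Embeds : ∀ P → (Position P → Q) → Q → Set o
    Embeds P ι x = ∀ p γ γs → δ (ι p) γ γs ≡ just (transition P ι x p γ γs)

    Runs : Configuration → ℕ → List O → Set o
    Runs s b v = ∃[ t ] t ≤ b × s ⇓[ t ] v

    weaken : ∀ {s b b′ v} → b ≤ b′ → Runs s b v → Runs s b′ v
    weaken b≤b′ (t , t≤b , r) = t , ℕ.≤-trans t≤b b≤b′ , r

    step′ : ∀ {s a s′ b v} → δ-at s ≡ just a → act a s ≡ s′ → Runs s′ b v → Runs s (suc b) v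
    step′ eq refl (t , t≤b , r) = suc t , s≤s t≤b , step eq r

    mutual

      -- Since `_⇓[_]_` describes only runs that end in a halt, runs of subprograms cannot be
      -- concatenated. Instead the run that continues after `P` is an argument and gets extended
      -- backwards through `P`.
      simulate : ∀ {P ts ts′ w} → P ⊢ ts ⇓ ts′ ∣ w →
                 ∀ ι x → Embeds P ι x → ∀ out {b v} →
                 Runs (configure x ts′ (out ++ w)) b v →
                 Runs (configure (ι (entry P)) ts out) (bound N P + b) v
      simulate (move {zero} {ts = t ∷ ts} refl) ι x emb out =
        step′ (emb _ _ _)
          (cong (λ ts → configuration x _ ts (out ++ [])) (perform-still ts))
      simulate (move {suc j} {ts = t ∷ ts} refl) ι x emb out =
        step′ (emb _ _ _)
          (cong (λ ts → configuration x t ts (out ++ [])) (perform-updateAt ts j λ _ → refl))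
      simulate (put {j} {ts = t ∷ ts} refl) ι x emb out =
        step′ (emb _ _ _)
          (cong (λ ts → configuration x t ts (out ++ [])) (perform-updateAt ts j λ _ → refl))
      simulate (emit {f} {ts = t ∷ ts} refl) ι x emb out =
        step′ (emb _ _ _)
          (cong (λ ts′ → configuration x t ts′ (out ++ f (Vec.map here (t ∷ ts)) ∷ []))
            (perform-still ts))
      simulate {P ⨾ R} (_⨾_ {ts = ts} {ts″ = ts″} {v = v} {w} p r) ι x emb out {b} run =
        weaken (ℕ.≤-reflexive (sym (ℕ.+-assoc (bound N P) (bound N R) b)))
          (simulate p (ι ∘ inj₁) (ι (inj₂ (entry R))) (emb ∘ inj₁) out
            (simulate r (ι ∘ inj₂) x (emb ∘ inj₂) (out ++ v)
              (subst (λ out → Runs (configure x ts″ out) b _) (sym (++-assoc out v w)) run)))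
      simulate {while i c P} (while n≤N it) ι x emb out {b} run =
        -- `simulate-loop` counts the actual iterations; here their number is replaced by `N`.
        weaken (s≤s (ℕ.+-monoˡ-≤ b (ℕ.*-monoˡ-≤ (suc (bound N P)) n≤N)))
          (simulate-loop it ι x emb out run)

      simulate-loop : ∀ {i c P n ts ts′ w} → Iterations i c P n ts ts′ w →
                      ∀ ι x → Embeds (while i c P) ι x → ∀ out {b v} →
                      Runs (configure x ts′ (out ++ w)) b v →
                      Runs (configure (ι (inj₁ tt)) ts out) (suc (n * suc (bound N P) + b)) v
      simulate-loop {i} {c} (stop {t ∷ ts} eq) ι x emb out =
        step′ (emb (inj₁ tt) (here t) (Vec.map here ts))
          (cong₂ (λ q ts → configuration q t ts (out ++ []))
          (cong (if_then _ else x) (trans (cong c (lookup-map i here (t ∷ ts))) eq))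
          (perform-still ts))
      simulate-loop {i} {c} {P} (again {ts = t ∷ ts} {ts″ = ts″} {v = v} {w} eq p it)
                    ι x emb out {b} run =
        step′ (emb (inj₁ tt) (here t) (Vec.map here ts))
          (cong₂ (λ q ts → configuration q t ts (out ++ []))
          (cong (if_then ι (inj₂ (entry P)) else x)
                (trans (cong c (lookup-map i here (t ∷ ts))) eq))
          (perform-still ts))
          (weaken (ℕ.≤-reflexive (trans (ℕ.+-suc (bound N P) _)
                                        (cong suc (sym (ℕ.+-assoc (bound N P) _ b)))))
            (simulate p (ι ∘ inj₂) (ι (inj₁ tt)) (emb ∘ inj₂) (out ++ [])
              -- The step of the test emits nothing and so turns the output into `out ++ []`.
              (subst (λ out → Runs (configure _ _ (out ++ v)) _ _) (sym (++-identityʳ out))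
                (simulate-loop it ι x emb (out ++ v)
                  (subst (λ out → Runs (configure x ts″ out) b _) (sym (++-assoc out v w)) run)))))

    machine-runs : ∀ {ts ts′ w} → P₀ ⊢ ts ⇓ ts′ ∣ w →
                   Runs (configure (inj₂ (entry P₀)) ts []) (bound N P₀) w
    machine-runs {ts′ = t ∷ ts} p = weaken (ℕ.≤-reflexive (ℕ.+-identityʳ _))
      (simulate p inj₂ (inj₁ tt) (λ _ _ _ → refl) [] (0 , z≤n , halt refl))

  initialTapes : List Bool → Tapes k
  initialTapes w = fromWord nothing (List.map just w) ∷ Vec.replicate k (fromWord nothing [])

  -- The length of the input serves as the limit `N` on the iterations of each loop, so `bound` at
  -- this length is a time bound, and `bound-polynomial` applies.
  program-polynomialTime : ∀ {i j} {X : Set i} {Y : Set j}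
    (u : X → List Bool) (v : Y → List O) (f : X → Y) (P : Program O k) →
    (∀ x → ∃[ ts ] (let open Semantics (length (u x)) in P ⊢ initialTapes (u x) ⇓ ts ∣ v (f x))) →
    PolynomialTime u v f
  program-polynomialTime u v f P runs with c , d , p ← bound-polynomial P
    = machine P , c , d , λ x →
        let t , t≤b , r = machine-runs P (length (u x)) (proj₂ (runs x))
        in t , ℕ.≤-trans t≤b (p (length (u x))) , r

-- The program that prints the codes

-- A tape with a blank cell on either side of the word ls ʳ++ w and the
-- head on the first letter of w; on a tape that is not `padded` the head has
-- not yet reached the blank on the right.

at : Bool → List Bool → List Bool → Tape Symbol
at padded ls []      = tape (List.map just ls ++ nothing ∷ []) nothing []
at padded ls (x ∷ w) = tape (List.map just ls ++ nothing ∷ []) (just x)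
  (List.map just w ++ (if padded then nothing ∷ [] else []))

at-rightward : ∀ padded ls x w →
               shift nothing rightward (at padded ls (x ∷ w)) ≡ at padded (x ∷ ls) w
at-rightward false ls x []      = refl
at-rightward true  ls x []      = refl
at-rightward _     ls x (_ ∷ _) = refl

at-leftward : ∀ x ls w → shift nothing leftward (at true (x ∷ ls) w) ≡ at true ls (x ∷ w)
at-leftward x ls []      = refl
at-leftward x ls (_ ∷ _) = refl

here-leftmost : ∀ w → here (shift nothing leftward (at true [] w)) ≡ nothing
here-leftmost []      = refl
here-leftmost (_ ∷ _) = refl

leave-and-return : ∀ w →
  shift nothing rightward (shift nothing leftward (at true [] w)) ≡ at true [] w
leave-and-return []      = refl
leave-and-return (_ ∷ _) = refl

-- The excursion creates the blank that `at` has on the left; the one on the right is still missing,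
-- hence `false`.
leave-and-return-fromWord : ∀ w →
  shift nothing rightward (shift nothing leftward (fromWord nothing (List.map just w))) ≡
  at false [] w
leave-and-return-fromWord []      = refl
leave-and-return-fromWord (x ∷ w) =
  cong (tape (nothing ∷ []) (just x)) (sym (++-identityʳ (List.map just w)))

is-true : Symbol → Bool
is-true = fromMaybe false

is-false : Symbol → Bool
is-false (just false) = true
is-false _            = false

-- The tapes K t are t at index i and do not depend on t elsewhere.

record Focus {k} (i : Fin (suc k)) (K : Tape Symbol → Tapes k) : Set where
  field
    lookup-focus   : ∀ t → lookup (K t) i ≡ t
    updateAt-focus : ∀ t f → updateAt (K t) i f ≡ K (f t)

open Focus

test-focus : ∀ {k} {i : Fin (suc k)} {K} → Focus i K → (c : Symbol → Bool) → ∀ {t x} →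
             c (here t) ≡ x → c (here (lookup (K t) i)) ≡ x
test-focus F c {t} eq = trans (cong (c ∘ here) (lookup-focus F t)) eq

-- Subprograms for loops over vertices and matrix entries

module _ {o} {O : Set o} {k : ℕ} where

  -- The first move leaves the blank on the right of the word, which would end the loop at once; the
  -- last one leaves the blank on the left.
  rewind : Fin (suc k) → Program O k
  rewind i = move i leftward ⨾ while i is-just (move i leftward) ⨾ move i rightward

  -- A unary number on the input becomes a word of that many cells `false` on both tapes. These
  -- words later count vertices and carry the marks.
  load : Fin k → Fin k → Program O k
  load a b =
    while zero is-true
      (put a (just false) ⨾ put b (just false) ⨾
       move (suc a) rightward ⨾ move (suc b) rightward ⨾ move zero rightward) ⨾
    move zero rightward ⨾ rewind (suc a) ⨾ rewind (suc b)

  skip : Program O k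
  skip = while zero is-true (move zero rightward) ⨾ move zero rightward

  -- The heads on the two work tapes follow the row and the column of the matrix entry under the
  -- input head, so the ends of their words tell when a row or the matrix is complete.
  scan : Fin k → Fin k → (Bool → Bool → Bool → O) → Program O k
  scan a b f =
    while (suc a) is-just
      (while (suc b) is-just
         (emit (λ γs → f (is-true (lookup γs zero)) (is-true (lookup γs (suc a)))
                         (is-true (lookup γs (suc b)))) ⨾
          move (suc b) rightward ⨾ move zero rightward) ⨾
       rewind (suc b) ⨾ move (suc a) rightward) ⨾
    rewind (suc a)

  count : Fin k → O → O → Program O k
  count a x y =
    while (suc a) is-just (emit (const x) ⨾ move (suc a) rightward) ⨾
    emit (const y) ⨾ rewind (suc a)

  -- The heads are rewound before `P` runs, which loses their place; the mark itself is then used to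
  -- find it again, and is erased before the next pass.
  forEachMark : Fin k → Fin k → Program O k → Program O k
  forEachMark a b P =
    while (suc a) is-just
      (put a (just true) ⨾ put b (just true) ⨾ rewind (suc a) ⨾ rewind (suc b) ⨾ P ⨾
       while (suc a) is-false (move (suc a) rightward ⨾ move (suc b) rightward) ⨾
       put a (just false) ⨾ put b (just false) ⨾
       move (suc a) rightward ⨾ move (suc b) rightward) ⨾
    rewind (suc a) ⨾ rewind (suc b)

  module _ (N : ℕ) where
    open Semantics {O = O} {k} N

    private variable
      i : Fin (suc k)
      P : Program O k
      ts ts′ ts″ : Tapes k
      K : Tape Symbol → Tapes k
      v w : List O

    output-≡ : v ≡ w → P ⊢ ts ⇓ ts′ ∣ v → P ⊢ ts ⇓ ts′ ∣ w
    output-≡ refl p = p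

    source-≡ : ts ≡ ts″ → P ⊢ ts ⇓ ts′ ∣ w → P ⊢ ts″ ⇓ ts′ ∣ w
    source-≡ refl p = p

    target-≡ : ts′ ≡ ts″ → P ⊢ ts ⇓ ts′ ∣ w → P ⊢ ts ⇓ ts″ ∣ w
    target-≡ refl p = p

    move-focus : Focus i K → ∀ d {t t′} → shift nothing d t ≡ t′ →
                 move i d ⊢ K t ⇓ K t′ ∣ []
    move-focus F d refl = move (updateAt-focus F _ _)

    put-focus : ∀ {j} → Focus (suc j) K → ∀ γ t → put j γ ⊢ K t ⇓ K (write γ t) ∣ []
    put-focus F γ t = put (updateAt-focus F _ _)

    -- Tapes are described as one step to the left of an `at`, because the final position, on the
    -- blank before the word, is not of the form `at` itself.
    rewind-loop : Focus i K → ∀ ls w →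
      Iterations i is-just (move i leftward) (length ls)
        (K (shift nothing leftward (at true ls w)))
        (K (shift nothing leftward (at true [] (ls ʳ++ w)))) []
    rewind-loop F []       w = stop (test-focus F is-just (cong is-just (here-leftmost w)))
    rewind-loop F (x ∷ ls) w rewrite at-leftward x ls w =
      again (test-focus F is-just refl) (move-focus F leftward refl) (rewind-loop F ls (x ∷ w))

    rewind-runs : Focus i K → ∀ ls w → length ls ≤ N →
                  rewind i ⊢ K (at true ls w) ⇓ K (at true [] (ls ʳ++ w)) ∣ []
    rewind-runs F ls w ls≤N =
      move-focus F leftward refl ⨾ while ls≤N (rewind-loop F ls w) ⨾
      move-focus F rightward (leave-and-return (ls ʳ++ w))

    reverse-end : ∀ {a} {A : Set a} (xs ys : List A) → ((xs ʳ++ ys) ʳ++ []) ≡ ys ʳ++ xs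
    reverse-end xs ys = trans (ʳ++-ʳ++ xs) (cong (ys ʳ++_) (++-identityʳ xs))

    rewind-end : Focus i K → ∀ w → length w ≤ N →
                 rewind i ⊢ K (at true (w ʳ++ []) []) ⇓ K (at true [] w) ∣ []
    rewind-end {K = K} F w w≤N =
      target-≡ (cong (K ∘ at true []) (reverse-end w []))
        (rewind-runs F (w ʳ++ []) []
          (ℕ.≤-trans (ℕ.≤-reflexive (trans (length-ʳ++ w) (ℕ.+-identityʳ _))) w≤N))

    module _ (K : Tape Symbol → Tapes k) (F : Focus zero K) (p : Bool) where

      skip-loop : ∀ n ls rest → Iterations zero is-true (move zero rightward) n
        (K (at p ls (unary n ++ rest))) (K (at p (List.replicate n true ʳ++ ls) (false ∷ rest))) []
      skip-loop zero    ls rest = stop (test-focus F is-true refl)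
      skip-loop (suc n) ls rest = again (test-focus F is-true refl)
        (move-focus F rightward (at-rightward p ls true _)) (skip-loop n (true ∷ ls) rest)

      skip-runs : ∀ n → n ≤ N → ∀ ls rest →
        skip ⊢ K (at p ls (unary n ++ rest)) ⇓ K (at p (unary n ʳ++ ls) rest) ∣ []
      skip-runs n n≤N ls rest rewrite ++-ʳ++ (List.replicate n true) {false ∷ []} {ls} =
        while n≤N (skip-loop n ls rest) ⨾ move-focus F rightward (at-rightward p _ false rest)

    module _ (K : Tape Symbol → Tape Symbol → Tape Symbol → Tapes k) {a b : Fin k}
             (F₀ : ∀ A B → Focus zero (λ I → K I A B))
             (F₁ : ∀ I B → Focus (suc a) (λ A → K I A B))
             (F₂ : ∀ I A → Focus (suc b) (λ B → K I A B)) where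

      load-loop : ∀ p n ls rest us →
        Iterations zero is-true
          (put a (just false) ⨾ put b (just false) ⨾
           move (suc a) rightward ⨾ move (suc b) rightward ⨾ move zero rightward) n
          (K (at p ls (unary n ++ rest)) (at true us []) (at true us []))
          (K (at p (List.replicate n true ʳ++ ls) (false ∷ rest))
             (at true (List.replicate n false ʳ++ us) [])
             (at true (List.replicate n false ʳ++ us) [])) []
      load-loop p zero    ls rest us = stop (test-focus (F₀ _ _) is-true refl)
      load-loop p (suc n) ls rest us = again (test-focus (F₀ _ _) is-true refl)
        (put-focus (F₁ _ _) _ _ ⨾ put-focus (F₂ _ _) _ _ ⨾
         move-focus (F₁ _ _) rightward refl ⨾ move-focus (F₂ _ _) rightward refl ⨾
         move-focus (F₀ _ _) rightward (at-rightward p ls true _))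
        (load-loop p n (true ∷ ls) rest (false ∷ us))

      load-runs : ∀ p n → n ≤ N → ∀ ls rest →
        load a b ⊢ K (at p ls (unary n ++ rest)) (at true [] []) (at true [] [])
                 ⇓ K (at p (unary n ʳ++ ls) rest) (at true [] (List.replicate n false))
                     (at true [] (List.replicate n false)) ∣ []
      load-runs p n n≤N ls rest rewrite ++-ʳ++ (List.replicate n true) {false ∷ []} {ls} =
        while n≤N (load-loop p n ls rest []) ⨾
        move-focus (F₀ _ _) rightward (at-rightward p _ false rest) ⨾
        rewind-end (F₁ _ _) _ length≤N ⨾ rewind-end (F₂ _ _) _ length≤N
        where
        length≤N : length (List.replicate n false) ≤ N
        length≤N = ℕ.≤-trans (ℕ.≤-reflexive (length-replicate n)) n≤N

      module _ (f : Bool → Bool → Bool → O) (p : Bool) where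

        letter : Vec Symbol (suc k) → O
        letter γs = f (is-true (lookup γs zero)) (is-true (lookup γs (suc a)))
                      (is-true (lookup γs (suc b)))

        letter-heads : ∀ I A B → letter (Vec.map here (K I A B)) ≡
                       f (is-true (here I)) (is-true (here A)) (is-true (here B))
        letter-heads I A B
          rewrite lookup-map zero here (K I A B)
                | lookup-map (suc a) here (K I A B)
                | lookup-map (suc b) here (K I A B)
                | lookup-focus (F₀ A B) I | lookup-focus (F₁ I B) A | lookup-focus (F₂ I A) B = refl

        row-loop : ∀ n (r y : Fin n → Bool) x ls us vs ws rest →
          Iterations (suc b) is-just
            (emit letter ⨾ move (suc b) rightward ⨾ move zero rightward) n
            (K (at p ls (List.tabulate r ++ rest)) (at true us (x ∷ vs))
               (at true ws (List.tabulate y)))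
            (K (at p (List.tabulate r ʳ++ ls) rest) (at true us (x ∷ vs))
               (at true (List.tabulate y ʳ++ ws) []))
            (List.tabulate (λ j → f (r j) x (y j)))
        row-loop zero    r y x ls us vs ws rest = stop (test-focus (F₂ _ _) is-just refl)
        row-loop (suc n) r y x ls us vs ws rest = again (test-focus (F₂ _ _) is-just refl)
          (emit (letter-heads _ _ _) ⨾
           move-focus (F₂ _ _) rightward (at-rightward true ws _ _) ⨾
           move-focus (F₀ _ _) rightward (at-rightward p ls _ _))
          (row-loop n (r ∘ suc) (y ∘ suc) x _ us vs _ rest)

        matrix-loop : ∀ m {n} → n ≤ N → (M : Fin m → Fin n → Bool) (x : Fin m → Bool)
          (y : Fin n → Bool) → ∀ ls us rest →
          Iterations (suc a) is-just
            (while (suc b) is-just (emit letter ⨾ move (suc b) rightward ⨾ move zero rightward) ⨾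
             rewind (suc b) ⨾ move (suc a) rightward) m
            (K (at p ls (rowMajor M ++ rest)) (at true us (List.tabulate x))
               (at true [] (List.tabulate y)))
            (K (at p (rowMajor M ʳ++ ls) rest) (at true (List.tabulate x ʳ++ us) [])
               (at true [] (List.tabulate y)))
            (rowMajor (λ i j → f (M i j) (x i) (y j)))
        matrix-loop zero    n≤N M x y ls us rest = stop (test-focus (F₁ _ _) is-just refl)
        matrix-loop (suc m) {n} n≤N M x y ls us rest
          rewrite ++-assoc (List.tabulate (M zero)) (rowMajor (M ∘ suc)) rest
                | ++-ʳ++ (List.tabulate (M zero)) {rowMajor (M ∘ suc)} {ls} =
          again (test-focus (F₁ _ _) is-just refl)
            (output-≡ (++-identityʳ _)
              (while n≤N (row-loop n (M zero) y (x zero) ls us _ [] _) ⨾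
               rewind-end (F₂ _ _) (List.tabulate y)
                 (ℕ.≤-trans (ℕ.≤-reflexive (length-tabulate y)) n≤N) ⨾
               move-focus (F₁ _ _) rightward (at-rightward true us _ _)))
            (matrix-loop m n≤N (M ∘ suc) (x ∘ suc) y _ _ rest)

        -- The words u and v are only equal to tabulations because the callers have them as constant
        -- or `marked` words.
        scan-runs : ∀ {m n} → m ≤ N → n ≤ N → (M : Fin m → Fin n → Bool) →
          ∀ {u v x y} → u ≡ List.tabulate x → v ≡ List.tabulate y → ∀ ls rest →
          scan a b f ⊢ K (at p ls (rowMajor M ++ rest)) (at true [] u) (at true [] v)
                     ⇓ K (at p (rowMajor M ʳ++ ls) rest) (at true [] u) (at true [] v)
                     ∣ rowMajor (λ i j → f (M i j) (x i) (y j))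
        scan-runs m≤N n≤N M {x = x} {y} refl refl ls rest = output-≡ (++-identityʳ _)
          (while m≤N (matrix-loop _ n≤N M x y ls [] rest) ⨾
           rewind-end (F₁ _ _) (List.tabulate x)
             (ℕ.≤-trans (ℕ.≤-reflexive (length-tabulate x)) m≤N))

    count-loop : ∀ {a} → Focus (suc a) K → ∀ x us w →
      Iterations (suc a) is-just (emit (const x) ⨾ move (suc a) rightward) (length w)
        (K (at true us w)) (K (at true (w ʳ++ us) [])) (List.replicate (length w) x)
    count-loop F x us []      = stop (test-focus F is-just refl)
    count-loop F x us (y ∷ w) = again (test-focus F is-just refl)
      (emit refl ⨾ move-focus F rightward (at-rightward true us y w))
      (count-loop F x (y ∷ us) w)

    count-runs : ∀ {a} → Focus (suc a) K → ∀ x y w → length w ≤ N →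
      count a x y ⊢ K (at true [] w) ⇓ K (at true [] w) ∣ List.replicate (length w) x ++ y ∷ []
    count-runs F x y w w≤N =
      while w≤N (count-loop F x [] w) ⨾ (emit refl ⨾ rewind-end F w w≤N)

-- Constant words and words with one mark

module _ {a} {A : Set a} where

  replicate-++-∷ : ∀ n (x : A) ys → List.replicate n x ++ x ∷ ys ≡ x ∷ List.replicate n x ++ ys
  replicate-++-∷ zero    x ys = refl
  replicate-++-∷ (suc n) x ys = cong (x ∷_) (replicate-++-∷ n x ys)

  replicate-ʳ++ : ∀ n (x : A) ys → List.replicate n x ʳ++ ys ≡ List.replicate n x ++ ys
  replicate-ʳ++ zero    x ys = refl
  replicate-ʳ++ (suc n) x ys = trans (replicate-ʳ++ n x (x ∷ ys)) (replicate-++-∷ n x ys)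

  tabulate-const : ∀ n (x : A) → List.tabulate {n = n} (const x) ≡ List.replicate n x
  tabulate-const zero    x = refl
  tabulate-const (suc n) x = cong (x ∷_) (tabulate-const n x)

  replicate-+ : ∀ m n (x : A) → List.replicate m x ++ List.replicate n x ≡ List.replicate (m + n) x
  replicate-+ zero    n x = refl
  replicate-+ (suc m) n x = cong (x ∷_) (replicate-+ m n x)

  rowMajor-const : ∀ m n (x : A) → rowMajor {m = m} {n} (λ _ _ → x) ≡ List.replicate (m * n) x
  rowMajor-const zero    n x = refl
  rowMajor-const (suc m) n x =
    trans (cong₂ _++_ (tabulate-const n x) (rowMajor-const m n x)) (replicate-+ n (m * n) x)

mark : ∀ {n} → ℕ → Fin n → Bool
mark l i = toℕ i ≡ᵇ l

marked : ℕ → ℕ → List Bool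
marked l r = List.replicate l false ++ true ∷ List.replicate r false

marked-tabulate : ∀ l r {n} → l + suc r ≡ n → marked l r ≡ List.tabulate {n = n} (mark l)
marked-tabulate zero    r refl = cong (true ∷_) (sym (tabulate-const r false))
marked-tabulate (suc l) r refl = cong (false ∷_) (marked-tabulate l r refl)

length-unary : ∀ n → n ≤ length (unary n)
length-unary n = ℕ.≤-trans (ℕ.≤-reflexive (sym (length-replicate n)))
  (length-++-≤ˡ (List.replicate n true))

majority : Bool → Bool → Bool → Bool
majority x y z = (y ∧ z) ∨ ((y ∨ z) ∧ x)

module _ {o} {O : Set o} {k : ℕ} (N : ℕ) where
  open Semantics {O = O} {k} N

  module _ (K : Tape Symbol → Tape Symbol → Tapes k) {a b : Fin k}
           (F₁ : ∀ B → Focus (suc a) (λ A → K A B)) (F₂ : ∀ A → Focus (suc b) (K A)) where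

    pair : List Bool → List Bool → Tapes k
    pair ls w = K (at true ls w) (at true ls w)

    seek-loop : ∀ l r us →
      Iterations (suc a) is-false (move (suc a) rightward ⨾ move (suc b) rightward) l
        (pair us (marked l r))
        (pair (List.replicate l false ʳ++ us) (true ∷ List.replicate r false)) []
    seek-loop zero    r us = stop (test-focus (F₁ _) is-false refl)
    seek-loop (suc l) r us = again (test-focus (F₁ _) is-false refl)
      (move-focus N (F₁ _) rightward (at-rightward true us _ _) ⨾
       move-focus N (F₂ _) rightward (at-rightward true us _ _))
      (seek-loop l r (false ∷ us))

    module _ {P : Program O k} {n} (n≤N : n ≤ N) (W : ℕ → List O)
             (run : ∀ l r → l + suc r ≡ n →
                    P ⊢ pair [] (marked l r) ⇓ pair [] (marked l r) ∣ W l) where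

      -- Invariant: both heads stand between l treated and r remaining cells. All cells are `false`,
      -- as each pass erases its own mark.
      mark-loop : ∀ l r → l + r ≡ n →
        Iterations (suc a) is-just
          (put a (just true) ⨾ put b (just true) ⨾ rewind (suc a) ⨾ rewind (suc b) ⨾ P ⨾
           while (suc a) is-false (move (suc a) rightward ⨾ move (suc b) rightward) ⨾
           put a (just false) ⨾ put b (just false) ⨾
           move (suc a) rightward ⨾ move (suc b) rightward) r
          (pair (List.replicate l false) (List.replicate r false))
          (pair (List.replicate n false) [])
          (List.concat (List.tabulate {n = r} (λ j → W (l + toℕ j))))
      mark-loop l zero    refl rewrite ℕ.+-identityʳ l = stop (test-focus (F₁ _) is-just refl)
      mark-loop l (suc r) eq   = again (test-focus (F₁ _) is-just refl) body rest
        where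
        left : length (List.replicate l false) ≤ N
        left = ℕ.≤-trans (ℕ.≤-reflexive (length-replicate l)) l≤N
          where
          l≤N : l ≤ N
          l≤N = ℕ.≤-trans (ℕ.≤-trans (ℕ.m≤m+n l (suc r)) (ℕ.≤-reflexive eq)) n≤N

        rewind-mark : ∀ {i K′} → Focus i K′ →
          rewind i ⊢ K′ (at true (List.replicate l false) (true ∷ List.replicate r false))
                   ⇓ K′ (at true [] (marked l r)) ∣ []
        rewind-mark {K′ = K′} F =
          target-≡ N (cong (K′ ∘ at true [])
              (replicate-ʳ++ l false (true ∷ List.replicate r false)))
            (rewind-runs N F (List.replicate l false) (true ∷ List.replicate r false) left)

        seek : while (suc a) is-false (move (suc a) rightward ⨾ move (suc b) rightward)
               ⊢ pair [] (marked l r)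
               ⇓ pair (List.replicate l false) (true ∷ List.replicate r false) ∣ []
        seek = target-≡ N
          (cong (λ ls → pair ls (true ∷ List.replicate r false))
            (trans (replicate-ʳ++ l false []) (++-identityʳ _)))
          (while (ℕ.≤-trans (ℕ.≤-reflexive (sym (length-replicate l))) left) (seek-loop l r []))

        body : _ ⊢ pair (List.replicate l false) (false ∷ List.replicate r false)
                 ⇓ pair (List.replicate (suc l) false) (List.replicate r false) ∣ W (l + 0)
        body = output-≡ N (trans (++-identityʳ _) (cong W (sym (ℕ.+-identityʳ l))))
          (put-focus N (F₁ _) _ _ ⨾ put-focus N (F₂ _) _ _ ⨾
           rewind-mark (F₁ _) ⨾ rewind-mark (F₂ _) ⨾ run l r eq ⨾ seek ⨾
           put-focus N (F₁ _) _ _ ⨾ put-focus N (F₂ _) _ _ ⨾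
           move-focus N (F₁ _) rightward (at-rightward true _ _ _) ⨾
           move-focus N (F₂ _) rightward (at-rightward true _ _ _))

        rest = subst (Iterations _ _ _ r _ _)
          (cong List.concat (tabulate-cong {n = r} (λ j → cong W (sym (ℕ.+-suc l (toℕ j))))))
          (mark-loop (suc l) r (trans (sym (ℕ.+-suc l r)) eq))

      forEachMark-runs : forEachMark a b P
        ⊢ pair [] (List.replicate n false) ⇓ pair [] (List.replicate n false)
        ∣ List.concat (List.tabulate {n = n} (W ∘ toℕ))
      forEachMark-runs = output-≡ N (++-identityʳ _)
        (while n≤N (mark-loop 0 n refl) ⨾ rewind-all (F₁ _) ⨾ rewind-all (F₂ _))
        where
        rewind-all : ∀ {i K′} → Focus i K′ →
          rewind i ⊢ K′ (at true (List.replicate n false) [])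
                   ⇓ K′ (at true [] (List.replicate n false)) ∣ []
        rewind-all {K′ = K′} F =
          target-≡ N (cong (K′ ∘ at true []) (trans (replicate-ʳ++ n false []) (++-identityʳ _)))
            (rewind-runs N F (List.replicate n false) []
              (ℕ.≤-trans (ℕ.≤-reflexive (length-replicate n)) n≤N))

-- The program of the reduction and its output

module _ {c} {X : Set c} (ι : Bool → X) where

  private
    O : Set c
    O = Bool ⊎ X

  entry-letter : Bool → Bool → Bool → O
  entry-letter x y z = inj₂ (ι (majority x y z))

  -- Each row extends over both blocks. Only the tapes of one graph carry a mark, and in the block
  -- of the other graph a majority with two values `false` prints zeros.
  row : Program O 4
  row = skip ⨾ scan 0F 1F entry-letter ⨾ skip ⨾ scan 2F 3F entry-letter ⨾ rewind zero

  -- The input head leaves the word and returns, so that the tape holds an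
  -- explicit blank on the left; `rewind` restores exactly this tape.

  prepare : Program O 4
  prepare =
    move 1F rightward ⨾ move 2F rightward ⨾ move 3F rightward ⨾ move 4F rightward ⨾
    move zero leftward ⨾ move zero rightward ⨾
    -- One letter for each entry of the two matrices gives the block length, a sum of two squares,
    -- in unary.
    load 0F 1F ⨾ scan 0F 1F (λ _ _ _ → inj₁ true) ⨾
    load 2F 3F ⨾ scan 2F 3F (λ _ _ _ → inj₁ true) ⨾
    emit (const (inj₁ false)) ⨾ rewind zero

  code : Fin 4 → Fin 4 → Program O 4
  code a b = count a (inj₁ true) (inj₁ false) ⨾ forEachMark a b row

  reduction : Program O 4
  reduction = prepare ⨾ code 0F 1F ⨾ code 2F 3F

  module _ {m n} (M : Fin m → Fin m → Bool) (M′ : Fin n → Fin n → Bool) where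

    input-word : List Bool
    input-word = (unary m ++ rowMajor M) ++ unary n ++ rowMajor M′

    N : ℕ
    N = length input-word

    open Semantics {O = O} {4} N

    m≤N : m ≤ N
    m≤N = ℕ.≤-trans (length-unary m)
      (ℕ.≤-trans (length-++-≤ˡ (unary m)) (length-++-≤ˡ (unary m ++ rowMajor M)))

    n≤N : n ≤ N
    n≤N = ℕ.≤-trans (length-unary n)
      (ℕ.≤-trans (length-++-≤ˡ (unary n))
        (length-++-≤ʳ (unary n ++ rowMajor M′) {unary m ++ rowMajor M}))

    input-assoc : input-word ≡ unary m ++ rowMajor M ++ unary n ++ rowMajor M′ ++ []
    input-assoc = trans (++-assoc (unary m) (rowMajor M) _)
      (cong (λ w → unary m ++ rowMajor M ++ unary n ++ w) (sym (++-identityʳ (rowMajor M′))))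

    input-reversed : rowMajor M′ ʳ++ unary n ʳ++ rowMajor M ʳ++ unary m ʳ++ [] ≡ input-word ʳ++ []
    input-reversed = sym (trans (++-ʳ++ (unary m ++ rowMajor M))
      (trans (++-ʳ++ (unary n)) (cong (λ w → rowMajor M′ ʳ++ unary n ʳ++ w) (++-ʳ++ (unary m)))))

    tapes : Tape Symbol → Tape Symbol → Tape Symbol → Tape Symbol → Tape Symbol → Tapes 4
    tapes I A B C D = I ∷ A ∷ B ∷ C ∷ D ∷ []

    loaded : List Bool → List Bool → Tapes 4
    loaded u v = tapes (at true [] input-word)
      (at true [] u) (at true [] u) (at true [] v) (at true [] v)

    f₀ : ∀ A B C D → Focus zero (λ I → tapes I A B C D)
    f₀ A B C D = record { lookup-focus = λ _ → refl ; updateAt-focus = λ _ _ → refl }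
    f₁ : ∀ I B C D → Focus 1F (λ A → tapes I A B C D)
    f₁ I B C D = record { lookup-focus = λ _ → refl ; updateAt-focus = λ _ _ → refl }
    f₂ : ∀ I A C D → Focus 2F (λ B → tapes I A B C D)
    f₂ I A C D = record { lookup-focus = λ _ → refl ; updateAt-focus = λ _ _ → refl }
    f₃ : ∀ I A B D → Focus 3F (λ C → tapes I A B C D)
    f₃ I A B D = record { lookup-focus = λ _ → refl ; updateAt-focus = λ _ _ → refl }
    f₄ : ∀ I A B C → Focus 4F (λ D → tapes I A B C D)
    f₄ I A B C = record { lookup-focus = λ _ → refl ; updateAt-focus = λ _ _ → refl }

    rewind-input : ∀ {A B C D} → rewind zero
      ⊢ tapes (at true (rowMajor M′ ʳ++ unary n ʳ++ rowMajor M ʳ++ unary m ʳ++ []) []) A B C D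
      ⇓ tapes (at true [] input-word) A B C D ∣ []
    rewind-input rewrite input-reversed = rewind-end N (f₀ _ _ _ _) input-word ℕ.≤-refl

    row-word : (Fin m → Bool) → (Fin n → Bool) → List O
    row-word x y = rowMajor (λ i j → entry-letter (M i j) (x i) (x j)) ++
                   rowMajor (λ i j → entry-letter (M′ i j) (y i) (y j))

    row-runs : ∀ {u v} x y → u ≡ List.tabulate x → v ≡ List.tabulate y →
               row ⊢ loaded u v ⇓ loaded u v ∣ row-word x y
    row-runs x y eq eq′ =
      output-≡ N (cong (rowMajor (λ i j → entry-letter (M i j) (x i) (x j)) ++_) (++-identityʳ _))
        (source-≡ N (cong (λ w → tapes (at true [] w) _ _ _ _) (sym input-assoc))
          (skip-runs N (λ I → tapes I _ _ _ _) (f₀ _ _ _ _) true m m≤N _ _ ⨾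
           scan-runs N (λ I A B → tapes I A B _ _) (λ _ _ → f₀ _ _ _ _) (λ _ _ → f₁ _ _ _ _)
             (λ _ _ → f₂ _ _ _ _) entry-letter true m≤N m≤N M eq eq _ _ ⨾
           skip-runs N (λ I → tapes I _ _ _ _) (f₀ _ _ _ _) true n n≤N _ _ ⨾
           scan-runs N (λ I C D → tapes I _ _ C D) (λ _ _ → f₀ _ _ _ _) (λ _ _ → f₃ _ _ _ _)
             (λ _ _ → f₄ _ _ _ _) entry-letter true n≤N n≤N M′ eq′ eq′ _ [] ⨾
           rewind-input))

    prepare-runs : prepare ⊢ initialTapes {O = O} input-word
      ⇓ loaded (List.replicate m false) (List.replicate n false)
      ∣ rowMajor {m = m} {m} (λ _ _ → inj₁ true) ++ rowMajor {m = n} {n} (λ _ _ → inj₁ true) ++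
        inj₁ false ∷ []
    prepare-runs =
      move-focus N (f₁ _ _ _ _) rightward refl ⨾ move-focus N (f₂ _ _ _ _) rightward refl ⨾
      move-focus N (f₃ _ _ _ _) rightward refl ⨾ move-focus N (f₄ _ _ _ _) rightward refl ⨾
      move-focus N (f₀ _ _ _ _) leftward refl ⨾
      move-focus N (f₀ _ _ _ _) rightward
        (trans (leave-and-return-fromWord input-word) (cong (at false []) input-assoc)) ⨾
      -- The first pass reads an input tape that is not padded. At the end of the word both forms of
      -- `at` coincide, so the rewound tape is padded.
      load-runs N on₁ (λ _ _ → f₀ _ _ _ _) (λ _ _ → f₁ _ _ _ _) (λ _ _ → f₂ _ _ _ _)
        false m m≤N [] _ ⨾
      scan-runs N on₁ (λ _ _ → f₀ _ _ _ _) (λ _ _ → f₁ _ _ _ _) (λ _ _ → f₂ _ _ _ _)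
        _ false m≤N m≤N M plain plain _ _ ⨾
      load-runs N on₂ (λ _ _ → f₀ _ _ _ _) (λ _ _ → f₃ _ _ _ _) (λ _ _ → f₄ _ _ _ _)
        false n n≤N _ _ ⨾
      scan-runs N on₂ (λ _ _ → f₀ _ _ _ _) (λ _ _ → f₃ _ _ _ _) (λ _ _ → f₄ _ _ _ _)
        _ false n≤N n≤N M′ plain plain _ [] ⨾
      emit refl ⨾
      rewind-input
      where
      plain : ∀ {n} → List.replicate n false ≡ List.tabulate {n = n} (const false)
      plain = sym (tabulate-const _ false)
      on₁ on₂ : Tape Symbol → Tape Symbol → Tape Symbol → Tapes 4
      on₁ I A B = tapes I A B (at true [] []) (at true [] [])
      on₂ I C D =
        tapes I (at true [] (List.replicate m false)) (at true [] (List.replicate m false)) C D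

    unary-letters : ℕ → List O
    unary-letters l = List.map inj₁ (unary l)

    count-word : ∀ l {w : List Bool} → length w ≡ l →
                 List.replicate (length w) (inj₁ {B = X} true) ++ inj₁ false ∷ [] ≡ unary-letters l
    count-word l refl = sym (trans (map-++ inj₁ (List.replicate l true) (false ∷ []))
      (cong (_++ inj₁ false ∷ []) (map-replicate inj₁ l true)))

    code-word₁ code-word₂ output-word : List O
    code-word₁ = unary-letters m ++
      List.concat (List.tabulate {n = m} λ v → row-word (mark (toℕ v)) (const false))
    code-word₂ = unary-letters n ++
      List.concat (List.tabulate {n = n} λ v → row-word (const false) (mark (toℕ v)))
    output-word = unary-letters (m * m + n * n) ++ code-word₁ ++ code-word₂

    code₁-runs : code 0F 1F
      ⊢ loaded (List.replicate m false) (List.replicate n false)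
      ⇓ loaded (List.replicate m false) (List.replicate n false)
      ∣ code-word₁
    code₁-runs =
      output-≡ N (count-word m {List.replicate m false} (length-replicate m))
        (count-runs N (f₁ _ _ _ _) _ _ (List.replicate m false)
          (ℕ.≤-trans (ℕ.≤-reflexive (length-replicate m)) m≤N)) ⨾
      forEachMark-runs N (λ A B → tapes _ A B _ _) (λ _ → f₁ _ _ _ _) (λ _ → f₂ _ _ _ _) m≤N
        (λ l → row-word (mark l) (const false))
        (λ l r eq → row-runs _ _ (marked-tabulate l r eq) (sym (tabulate-const n false)))

    code₂-runs : code 2F 3F
      ⊢ loaded (List.replicate m false) (List.replicate n false)
      ⇓ loaded (List.replicate m false) (List.replicate n false)
      ∣ code-word₂
    code₂-runs =
      output-≡ N (count-word n {List.replicate n false} (length-replicate n))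
        (count-runs N (f₃ _ _ _ _) _ _ (List.replicate n false)
          (ℕ.≤-trans (ℕ.≤-reflexive (length-replicate n)) n≤N)) ⨾
      forEachMark-runs N (λ C D → tapes _ _ _ C D) (λ _ → f₃ _ _ _ _) (λ _ → f₄ _ _ _ _) n≤N
        (λ l → row-word (const false) (mark l))
        (λ l r eq → row-runs _ _ (sym (tabulate-const m false)) (marked-tabulate l r eq))

    reduction-runs : reduction ⊢ initialTapes {O = O} input-word
      ⇓ loaded (List.replicate m false) (List.replicate n false) ∣ output-word
    reduction-runs = output-≡ N blocklength prepare-runs ⨾ code₁-runs ⨾ code₂-runs
      where
      blocklength = begin
        rowMajor {m = m} {m} (λ _ _ → inj₁ true) ++
        rowMajor {m = n} {n} (λ _ _ → inj₁ true) ++ inj₁ false ∷ []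
          ≡⟨ cong₂ (λ u v → u ++ v ++ inj₁ false ∷ [])
                   (rowMajor-const m m _) (rowMajor-const n n _) ⟩
        List.replicate (m * m) (inj₁ true) ++ List.replicate (n * n) (inj₁ true) ++ inj₁ false ∷ []
          ≡⟨ ++-assoc (List.replicate (m * m) _) _ _ ⟨
        (List.replicate (m * m) (inj₁ true) ++ List.replicate (n * n) (inj₁ true)) ++
        inj₁ false ∷ []
          ≡⟨ cong (_++ inj₁ false ∷ []) (replicate-+ (m * m) (n * n) _) ⟩
        List.replicate (m * m + n * n) (inj₁ true) ++ inj₁ false ∷ []
          ≡⟨ cong (_++ inj₁ false ∷ []) (map-replicate inj₁ (m * m + n * n) true) ⟨
        List.map inj₁ (List.replicate (m * m + n * n) true) ++ inj₁ false ∷ []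
          ≡⟨ map-++ inj₁ (List.replicate (m * m + n * n) true) (false ∷ []) ⟨
        unary-letters (m * m + n * n) ∎
        where open ≡-Reasoning

-- Codes of graphs

mark-refl : ∀ {n} (i : Fin n) → mark (toℕ i) i ≡ true
mark-refl i = Equivalence.to T-≡ (≡⇒≡ᵇ (toℕ i) (toℕ i) refl)

mark⇒≡ : ∀ {n} {i j : Fin n} → mark (toℕ i) j ≡ true → i ≡ j
mark⇒≡ {i = i} {j} eq = toℕ-injective (sym (≡ᵇ⇒≡ (toℕ j) (toℕ i) (Equivalence.from T-≡ eq)))

mark-≢ : ∀ {n} {i j : Fin n} → j ≢ i → mark (toℕ i) j ≡ false
mark-≢ {i = i} {j} j≢i with mark (toℕ i) j in eq
... | false = refl
... | true  = contradiction (sym (mark⇒≡ eq)) j≢i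

mark-permute : ∀ {m n} (σ : Permutation m n) i j →
               mark (toℕ i) (σ ⟨$⟩ˡ j) ≡ mark (toℕ (σ ⟨$⟩ʳ i)) j
mark-permute σ i j = ⇔→≡ (mk⇔
  (λ eq → trans (cong (λ x → mark (toℕ x) j)
                  (trans (cong (σ ⟨$⟩ʳ_) (mark⇒≡ eq)) (inverseʳ σ))) (mark-refl j))
  (λ eq → trans (cong (λ x → mark (toℕ i) (σ ⟨$⟩ˡ x)) (sym (mark⇒≡ eq)))
                (trans (cong (mark (toℕ i)) (inverseˡ σ)) (mark-refl i))))

majority-comm : ∀ x y z → majority x y z ≡ majority x z y
majority-comm x y z = cong₂ (λ u v → u ∨ (v ∧ x)) (∧-comm y z) (∨-comm y z)

majority-diagonal : ∀ x y → majority x y y ≡ y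
majority-diagonal x true  = refl
majority-diagonal x false = refl

majority-true : ∀ x y z → majority x y z ≡ true →
                (y ≡ true × z ≡ true) ⊎ (x ≡ true × (y ≡ true ⊎ z ≡ true))
majority-true x    true  true  _  = inj₁ (refl , refl)
majority-true true true  false _  = inj₂ (refl , inj₁ refl)
majority-true true false true  _  = inj₂ (refl , inj₂ refl)

-- The column at (i , j) is the incidence vector of {i , j} if i and j are
-- equal or adjacent, and zero otherwise.

incidence : (G : Graph) → let open Graph G in Fin order × Fin order → Fin order → Bool
incidence G (i , j) v = majority (Graph.adjacent G i j) (mark (toℕ v) i) (mark (toℕ v) j)

-- The graph is recovered from these properties of the columns alone, wherever the columns stand;
-- they survive every permutation of positions, as `permuteLayout` shows.
record Layout (G : Graph) (P : Set) : Set where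
  open Graph G
  field
    column    : P → Fin order → Bool
    pos       : Fin order × Fin order → P
    pos-inj   : ∀ {q r} → pos q ≡ pos r → q ≡ r
    column-at : ∀ q v → column (pos q) v ≡ incidence G q v
    elsewhere : ∀ p → (∃[ q ] p ≡ pos q) ⊎ (∀ v → column p v ≡ false)

  column-diagonal : ∀ i v → column (pos (i , i)) v ≡ mark (toℕ v) i
  column-diagonal i v = trans (column-at (i , i) v) (majority-diagonal _ _)

  column-self : ∀ i → column (pos (i , i)) i ≡ true
  column-self i = trans (column-diagonal i i) (mark-refl i)

  column-other : ∀ {i v} → v ≢ i → column (pos (i , i)) v ≡ false
  column-other {i} {v} v≢i = trans (column-diagonal i v) (mark-≢ (v≢i ∘ sym))

  column-swap : ∀ i j v → column (pos (i , j)) v ≡ column (pos (j , i)) v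
  column-swap i j v = begin
    column (pos (i , j)) v    ≡⟨ column-at (i , j) v ⟩
    incidence G (i , j) v     ≡⟨ majority-comm (adjacent i j) (mark (toℕ v) i) (mark (toℕ v) j) ⟩
    majority (adjacent i j) (mark (toℕ v) j) (mark (toℕ v) i)
      ≡⟨ cong (λ a → majority a (mark (toℕ v) j) (mark (toℕ v) i)) (symmetric i j) ⟩
    incidence G (j , i) v     ≡⟨ column-at (j , i) v ⟨
    column (pos (j , i)) v    ∎
    where open ≡-Reasoning

  column-endpoint : ∀ {i j} → adjacent i j ≡ true → column (pos (i , j)) i ≡ true
  column-endpoint {i} {j} ij = trans (column-at (i , j) i)
    (trans (cong₂ (λ a x → majority a x (mark (toℕ i) j)) ij (mark-refl i))
           (lemma (mark (toℕ i) j)))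
    where
    lemma : ∀ x → majority true true x ≡ true
    lemma true  = refl
    lemma false = refl

  column-support : ∀ {i j v} → column (pos (i , j)) v ≡ true →
                   (v ≡ i × v ≡ j) ⊎ (adjacent i j ≡ true × (v ≡ i ⊎ v ≡ j))
  column-support {i} {j} {v} eq =
    Sum.map (Product.map mark⇒≡ mark⇒≡) (Product.map₂ (Sum.map mark⇒≡ mark⇒≡))
      (majority-true _ _ _ (trans (sym (column-at (i , j) v)) eq))

  -- A zero column is excluded by the one at i. The column of an edge has ones at both endpoints, so
  -- both would be i, and a diagonal column has its one at its own vertex.
  unit-column : ∀ {p i} → column p i ≡ true → (∀ v → column p v ≡ true → v ≡ i) → p ≡ pos (i , i)
  unit-column {p} {i} pi only with elsewhere p
  ... | inj₂ zeros = contradiction (trans (sym pi) (zeros i)) λ ()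
  ... | inj₁ ((x , y) , refl) with column-support pi
  ...   | inj₁ (refl , refl) = refl
  ...   | inj₂ (xy , _)      = cong₂ (λ x y → pos (x , y)) (only x (column-endpoint xy))
          (only y (trans (column-swap x y y) (column-endpoint (trans (symmetric y x) xy))))

  -- Two distinct ones exclude zero and diagonal columns. What remains is the column of an edge,
  -- with i and j as its endpoints in one order or the other.
  edge-column : ∀ {p i j} → i ≢ j → column p i ≡ true → column p j ≡ true → adjacent i j ≡ true
  edge-column {p} {i} i≢j pi pj with elsewhere p
  ... | inj₂ zeros = contradiction (trans (sym pi) (zeros i)) λ ()
  ... | inj₁ ((x , y) , refl) with column-support pi | column-support pj
  ...   | inj₁ (i≡x , i≡y)   | inj₁ (j≡x , _)          = contradiction (trans i≡x (sym j≡x)) i≢j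
  ...   | inj₁ (i≡x , i≡y)   | inj₂ (_ , inj₁ j≡x)     = contradiction (trans i≡x (sym j≡x)) i≢j
  ...   | inj₁ (i≡x , i≡y)   | inj₂ (_ , inj₂ j≡y)     = contradiction (trans i≡y (sym j≡y)) i≢j
  ...   | inj₂ (_ , inj₁ i≡x) | inj₁ (j≡x , _)         = contradiction (trans i≡x (sym j≡x)) i≢j
  ...   | inj₂ (_ , inj₂ i≡y) | inj₁ (_ , j≡y)         = contradiction (trans i≡y (sym j≡y)) i≢j
  ...   | inj₂ (_ , inj₁ i≡x) | inj₂ (_ , inj₁ j≡x)    = contradiction (trans i≡x (sym j≡x)) i≢j
  ...   | inj₂ (_ , inj₂ i≡y) | inj₂ (_ , inj₂ j≡y)    = contradiction (trans i≡y (sym j≡y)) i≢j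
  ...   | inj₂ (xy , inj₁ refl) | inj₂ (_ , inj₂ refl) = xy
  ...   | inj₂ (xy , inj₂ refl) | inj₂ (_ , inj₁ refl) = trans (symmetric _ _) xy

-- Layouts of two graphs on a common set of columns

permuteLayout : ∀ {G P} → P ↔ P → Layout G P → Layout G P
permuteLayout π L = record
  { column    = column ∘ to
  ; pos       = from ∘ pos
  ; pos-inj   = λ eq → pos-inj
      (trans (sym (strictlyInverseˡ _)) (trans (cong to eq) (strictlyInverseˡ _)))
  ; column-at = λ q v → trans (cong (λ p → column p v) (strictlyInverseˡ (pos q))) (column-at q v)
  ; elsewhere = λ p → Sum.map₁
      (λ (q , eq) → q , trans (sym (strictlyInverseʳ p)) (cong from eq)) (elsewhere (to p))
  }
  where
  open Layout L
  open Inverse π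

position : ∀ {m n} → Fin (m * m + n * n) ↔ ((Fin m × Fin m) ⊎ (Fin n × Fin n))
position = ↔-trans +↔⊎ (*↔× ⊎-↔ *↔×)

extendByZero : ∀ {Q B V : Set} → (Q → V → Bool) → Q ⊎ B → V → Bool
extendByZero x = [ x , (λ _ _ → false) ]′

-- With an arbitrary second summand the construction serves G on the first block and, after a swap
-- of the summands, H on the second.
layoutOn : ∀ {P B : Set} G → P ↔ ((Fin (Graph.order G) × Fin (Graph.order G)) ⊎ B) → Layout G P
layoutOn G e = record
  { column    = λ p → extendByZero (incidence G) (to p)
  ; pos       = from ∘ inj₁
  ; pos-inj   = λ {q} {r} eq → inj₁-injective
      (trans (sym (strictlyInverseˡ (inj₁ q))) (trans (cong to eq) (strictlyInverseˡ (inj₁ r))))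
  ; column-at = λ q v → cong (λ s → extendByZero (incidence G) s v) (strictlyInverseˡ (inj₁ q))
  ; elsewhere = λ p → split p (to p) refl
  }
  where
  open Inverse e
  split : ∀ p s → to p ≡ s → (∃[ q ] p ≡ from (inj₁ q)) ⊎
          (∀ v → extendByZero (incidence G) (to p) v ≡ false)
  split p (inj₁ q) eq = inj₁ (q , trans (sym (strictlyInverseʳ p)) (cong from eq))
  split p (inj₂ b) eq = inj₂ (λ v → cong (λ s → extendByZero (incidence G) s v) eq)

module _ (G H : Graph) where
  private
    module G = Graph G
    module H = Graph H

  length² : ℕ
  length² = G.order * G.order + H.order * H.order

  layout₁ : Layout G (Fin length²)
  layout₁ = layoutOn G (position {G.order} {H.order})

  layout₂ : Layout H (Fin length²)
  layout₂ = layoutOn H (↔-trans (position {G.order} {H.order}) (⊎-comm _ _))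

  module _ (σ : Permutation G.order H.order)
           (σ-adj : ∀ i j → G.adjacent i j ≡ H.adjacent (σ ⟨$⟩ʳ i) (σ ⟨$⟩ʳ j)) where

    -- The nonzero columns of the two codes lie in different blocks, so the isomorphism has to act
    -- as a swap of the blocks.
    exchange : ((Fin G.order × Fin G.order) ⊎ (Fin H.order × Fin H.order)) ↔
               ((Fin G.order × Fin G.order) ⊎ (Fin H.order × Fin H.order))
    exchange = ↔-trans (⊎-comm _ _) ((↔-sym σ ×-↔ ↔-sym σ) ⊎-↔ (σ ×-↔ σ))

    exchangeColumns : Permutation′ length²
    exchangeColumns = ↔-trans position (↔-trans exchange (↔-sym position))

    incidence-permute : ∀ q w →
      incidence G (Product.map (σ ⟨$⟩ˡ_) (σ ⟨$⟩ˡ_) q) w ≡ incidence H q (σ ⟨$⟩ʳ w)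
    incidence-permute (i , j) w
      rewrite σ-adj (σ ⟨$⟩ˡ i) (σ ⟨$⟩ˡ j) | inverseʳ σ {i} | inverseʳ σ {j}
            | mark-permute σ w i | mark-permute σ w j = refl

    column-exchange : ∀ p w → Layout.column layout₁ (exchangeColumns ⟨$⟩ʳ p) w ≡
                              Layout.column layout₂ p (σ ⟨$⟩ʳ w)
    column-exchange p w = trans
      (cong (λ s → extendByZero (incidence G) s w)
        (Inverse.strictlyInverseˡ position (Inverse.to exchange (Inverse.to position p))))
      (lemma (Inverse.to position p))
      where
      lemma : ∀ s → extendByZero (incidence G) (Inverse.to exchange s) w ≡
                    extendByZero (incidence H) (Sum.swap s) (σ ⟨$⟩ʳ w)
      lemma (inj₁ q) = refl
      lemma (inj₂ q) = incidence-permute q w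

-- Rows of a code as words

module _ {a} {A : Set a} where

  tabulate-+ : ∀ m {n} (f : Fin (m + n) → A) →
               List.tabulate f ≡ List.tabulate (f ∘ (_↑ˡ n)) ++ List.tabulate (f ∘ (m ↑ʳ_))
  tabulate-+ zero    f = refl
  tabulate-+ (suc m) f = cong (f zero ∷_) (tabulate-+ m (f ∘ suc))

  tabulate-* : ∀ m {n} (f : Fin (m * n) → A) →
               List.tabulate f ≡ rowMajor (λ i j → f (combine {m} {n} i j))
  tabulate-* zero        f = refl
  tabulate-* (suc m) {n} f = trans (tabulate-+ n f)
    (cong (List.tabulate (f ∘ (_↑ˡ (m * n))) ++_) (tabulate-* m (f ∘ (n ↑ʳ_))))

  rowMajor-cong : ∀ {m n} {f g : Fin m → Fin n → A} → (∀ i j → f i j ≡ g i j) →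
                  rowMajor f ≡ rowMajor g
  rowMajor-cong eq = cong List.concat (tabulate-cong (λ i → tabulate-cong (eq i)))

  -- `position` numbers the columns in the order in which the program prints them: the first block
  -- row by row, then the second.
  tabulate-blocks : ∀ m {n} {f : Fin (m * m + n * n) → A} {g h} →
    (∀ i j → f (Inverse.from (position {m} {n}) (inj₁ (i , j))) ≡ g i j) →
    (∀ i j → f (Inverse.from (position {m} {n}) (inj₂ (i , j))) ≡ h i j) →
    List.tabulate f ≡ rowMajor g ++ rowMajor h
  tabulate-blocks m {n} {f} eq eq′ = trans (tabulate-+ (m * m) f)
    (cong₂ _++_ (trans (tabulate-* m _) (rowMajor-cong eq))
                (trans (tabulate-* n _) (rowMajor-cong eq′)))

map-rowMajor : ∀ {a b} {A : Set a} {B : Set b} (f : A → B) {m n} (M : Fin m → Fin n → A) →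
               List.map f (rowMajor M) ≡ rowMajor (λ i j → f (M i j))
map-rowMajor f M = trans (sym (concat-map (List.tabulate (λ i → List.tabulate (M i)))))
  (cong List.concat (trans (map-tabulate _ _) (tabulate-cong (λ i → map-tabulate (M i) f))))

-- Graph codes over a field and correctness of the reduction

module _ {c ℓ} (F : Field c ℓ) where
  open Field F hiding (_+_; _*_; zero)
    renaming (refl to ≈-refl; sym to ≈-sym; trans to ≈-trans; reflexive to ≈-reflexive)
  private
    module F = Field F
  open import Algebra.Properties.Semiring.Sum semiring
    using (sum; sum-cong-≋; sum-remove; sum-permute; sum-replicate-zero; ∑-distrib-+)
  open import Relation.Binary.Reasoning.Setoid setoid

  ι : Bool → Carrier
  ι b = if b then 1# else 0#

  -- Equality in the field need not be decidable, so case distinctions on columns are made on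
  -- Booleans; equations between field elements are brought back to Booleans by this lemma.
  ι-injective : ∀ x y → ι x ≈ ι y → x ≡ y
  ι-injective true  true  _  = refl
  ι-injective false false _  = refl
  ι-injective true  false eq = contradiction (≈-sym eq) 0≉1
  ι-injective false true  eq = contradiction eq 0≉1

  ι-cong : ∀ {x y} → x ≡ y → ι x ≈ ι y
  ι-cong eq = ≈-reflexive (cong ι eq)

  sum-zero : ∀ {n} (f : Fin n → Carrier) → (∀ i → f i ≈ 0#) → sum f ≈ 0#
  sum-zero {n} f eq = ≈-trans (sum-cong-≋ eq) (sum-replicate-zero n)

  sum-indicator : ∀ {n} (a : Fin n → Carrier) (x : Fin n → Bool) i → x i ≡ true →
                  (∀ {j} → j ≢ i → x j ≡ false) → sum (λ j → a j F.* ι (x j)) ≈ a i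
  sum-indicator {suc n} a x i xi others = begin
    sum (λ j → a j F.* ι (x j))
      ≈⟨ sum-remove {i = i} (λ j → a j F.* ι (x j)) ⟩
    a i F.* ι (x i) F.+ sum (λ j → a (punchIn i j) F.* ι (x (punchIn i j)))
      ≈⟨ +-cong (≈-trans (*-congˡ (ι-cong xi)) (*-identityʳ (a i)))
           (sum-zero _ (λ j → ≈-trans (*-congˡ (ι-cong (others (punchInᵢ≢i i j)))) (zeroʳ _))) ⟩
    a i F.+ 0#
      ≈⟨ +-identityʳ (a i) ⟩
    a i ∎

  graphCode : ∀ {G N} → Layout G (Fin N) → Code F N
  graphCode {G} L = record
    { dimension   = order
    ; basis       = λ v p → ι (column p v)
    -- At the unit column of i the combination is the coefficient `a i`.
    ; independent = λ a eq i → ≈-trans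
        (≈-sym (sum-indicator a (column (pos (i , i))) i (column-self i) column-other))
        (eq (pos (i , i)))
    }
    where
    open Graph G
    open Layout L

  -- The columns x′ p are the images of the columns x p under one linear map.

  Transforms : ∀ {P : Set} {m n} → (P → Fin m → Bool) → (P → Fin n → Bool) → Set (c ⊔ ℓ)
  Transforms {P} {m} {n} x x′ =
    Σ[ A ∈ (Fin n → Fin m → Carrier) ]
      ∀ p w → ι (x′ p w) ≈ sum (λ v → A w v F.* ι (x p v))

  module _ {P : Set} {m n : ℕ} {x : P → Fin m → Bool} {x′ : P → Fin n → Bool}
           (T : Transforms x x′) where
    private
      A : Fin n → Fin m → Carrier
      A = proj₁ T
      A-eq : ∀ p w → ι (x′ p w) ≈ sum (λ v → A w v F.* ι (x p v))
      A-eq = proj₂ T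

    transform-zero : ∀ {p} → (∀ v → x p v ≡ false) → ∀ w → x′ p w ≡ false
    transform-zero {p} eq w = ι-injective _ _ (≈-trans (A-eq p w)
      (sum-zero _ (λ v → ≈-trans (*-congˡ (ι-cong (eq v))) (zeroʳ (A w v)))))

    transform-≡ : ∀ {p q} → (∀ v → x p v ≡ x q v) → ∀ w → x′ p w ≡ x′ q w
    transform-≡ {p} {q} eq w = ι-injective _ _ (≈-trans (A-eq p w)
      (≈-trans (sum-cong-≋ (λ v → *-congˡ (ι-cong (eq v)))) (≈-sym (A-eq q w))))

    transform-+ : ∀ {p q r} → (∀ v → ι (x p v) ≈ ι (x q v) F.+ ι (x r v)) →
                  ∀ w → ι (x′ p w) ≈ ι (x′ q w) F.+ ι (x′ r w)
    transform-+ {p} {q} {r} eq w = begin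
      ι (x′ p w)
        ≈⟨ A-eq p w ⟩
      sum (λ v → A w v F.* ι (x p v))
        ≈⟨ sum-cong-≋ (λ v → ≈-trans (*-congˡ (eq v)) (distribˡ (A w v) _ _)) ⟩
      sum (λ v → A w v F.* ι (x q v) F.+ A w v F.* ι (x r v))
        ≈⟨ ∑-distrib-+ (λ v → A w v F.* ι (x q v)) (λ v → A w v F.* ι (x r v)) ⟩
      sum (λ v → A w v F.* ι (x q v)) F.+ sum (λ v → A w v F.* ι (x r v))
        ≈⟨ +-cong (A-eq q w) (A-eq r w) ⟨
      ι (x′ q w) F.+ ι (x′ r w) ∎

  module _ {G H : Graph} {P : Set} (L : Layout G P) (L′ : Layout H P) where
    private
      module G = Graph G
      module H = Graph H
      module L = Layout L
      module L′ = Layout L′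

    -- Unlike the column of an edge, a unit column occurs only once.

    diagonal : Transforms L.column L′.column → Transforms L′.column L.column →
               ∀ i → ∃[ k ] L′.pos (i , i) ≡ L.pos (k , k)
    diagonal T T′ i with L.elsewhere (L′.pos (i , i))
    -- The map T takes a zero column to zero, but a unit column is not zero.
    ... | inj₂ zeros =
      contradiction (trans (sym (L′.column-self i)) (transform-zero T zeros i)) λ ()
    ... | inj₁ ((k , l) , eq) with k ≟ l
    ...   | yes refl = k , eq
    -- By symmetry the column at (k , l) occurs again at (l , k), and so does its image under T. The
    -- image is a unit column, which has a single position.
    ...   | no k≢l   = contradiction (cong proj₁ (L.pos-inj (trans (sym eq) (sym same)))) k≢l
      where
      columns : ∀ v → L′.column (L.pos (l , k)) v ≡ L′.column (L′.pos (i , i)) v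
      columns = transform-≡ T
        (λ v → trans (L.column-swap l k v) (cong (λ p → L.column p v) (sym eq)))

      same : L.pos (l , k) ≡ L′.pos (i , i)
      same = L′.unit-column (trans (columns i) (L′.column-self i))
        (λ v eq → mark⇒≡ (trans (sym (L′.column-diagonal i v)) (trans (sym (columns v)) eq)))

    -- The column of an edge is the sum of the unit columns of its endpoints. The linear map
    -- preserves this relation, so in L the same position has ones at `σ i` and `σ j`, which are
    -- distinct; `edge-column` then gives the adjacency.
    edge : Transforms L′.column L.column → (σ : Fin H.order → Fin G.order) →
           (∀ i → L′.pos (i , i) ≡ L.pos (σ i , σ i)) →
           ∀ {i j} → H.adjacent i j ≡ true → G.adjacent (σ i) (σ j) ≡ true
    edge T′ σ σ-eq {i} {j} ij = L.edge-column {L′.pos (i , j)} σi≢σj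
      (ι-injective _ _ (begin
        ι (L.column (L′.pos (i , j)) (σ i))   ≈⟨ columns (σ i) ⟩
        _ ≈⟨ +-cong (ι-cong (L.column-self (σ i))) (ι-cong (L.column-other σi≢σj)) ⟩
        1# F.+ 0#                             ≈⟨ +-identityʳ 1# ⟩
        1#                                    ∎))
      (ι-injective _ _ (begin
        ι (L.column (L′.pos (i , j)) (σ j))   ≈⟨ columns (σ j) ⟩
        _ ≈⟨ +-cong (ι-cong (L.column-other (σi≢σj ∘ sym))) (ι-cong (L.column-self (σ j))) ⟩
        0# F.+ 1#                             ≈⟨ +-identityˡ 1# ⟩
        1#                                    ∎))
      where
      i≢j : i ≢ j
      i≢j refl = contradiction (trans (sym ij) (H.irreflexive i)) λ ()

      σi≢σj : σ i ≢ σ j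
      σi≢σj eq = i≢j (cong proj₁ (L′.pos-inj
        (trans (σ-eq i) (trans (cong (λ k → L.pos (k , k)) eq) (sym (σ-eq j))))))

      -- Disjunction and sum agree unless both values are `true`; this avoids 1 + 1, which depends
      -- on the characteristic.
      disjoint : ∀ x y → ¬ (x ≡ true × y ≡ true) → ι (majority true x y) ≈ ι x F.+ ι y
      disjoint true  true  both = contradiction (refl , refl) both
      disjoint true  false _    = ≈-sym (+-identityʳ 1#)
      disjoint false true  _    = ≈-sym (+-identityˡ 1#)
      disjoint false false _    = ≈-sym (+-identityˡ 0#)

      split : ∀ v → ι (L′.column (L′.pos (i , j)) v) ≈
                    ι (L′.column (L′.pos (i , i)) v) F.+ ι (L′.column (L′.pos (j , j)) v)
      split v = begin
        ι (L′.column (L′.pos (i , j)) v)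
          ≈⟨ ι-cong (trans (L′.column-at (i , j) v)
               (cong (λ a → majority a (mark (toℕ v) i) (mark (toℕ v) j)) ij)) ⟩
        ι (majority true (mark (toℕ v) i) (mark (toℕ v) j))
          ≈⟨ disjoint _ _ (λ (vi , vj) → i≢j (trans (sym (mark⇒≡ vi)) (mark⇒≡ vj))) ⟩
        ι (mark (toℕ v) i) F.+ ι (mark (toℕ v) j)
          ≈⟨ +-cong (ι-cong (L′.column-diagonal i v)) (ι-cong (L′.column-diagonal j v)) ⟨
        ι (L′.column (L′.pos (i , i)) v) F.+ ι (L′.column (L′.pos (j , j)) v) ∎

      columns : ∀ v → ι (L.column (L′.pos (i , j)) v) ≈
                      ι (L.column (L.pos (σ i , σ i)) v) F.+ ι (L.column (L.pos (σ j , σ j)) v)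
      columns v = ≈-trans (transform-+ T′ split v)
        (+-cong (ι-cong (cong (λ p → L.column p v) (σ-eq i)))
                (ι-cong (cong (λ p → L.column p v) (σ-eq j))))

  -- By `diagonal` in both directions, the two layouts have their unit columns at the same
  -- positions. Reading the vertex of such a position in either layout gives mutually inverse maps,
  -- and `edge` shows that both preserve adjacency.
  transforms⇒≅ : ∀ {G H P} (L : Layout G P) (L′ : Layout H P) →
                 Transforms (Layout.column L) (Layout.column L′) →
                 Transforms (Layout.column L′) (Layout.column L) → G ≅ H
  transforms⇒≅ {G} {H} L L′ T T′ =
    permutation τ σ τσ στ ,
    λ k l → ⇔→≡ (mk⇔
      (edge L′ L T τ τ-eq)
      (λ eq → trans (sym (cong₂ G.adjacent (στ k) (στ l))) (edge L L′ T′ σ σ-eq eq)))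
    where
    module G = Graph G
    module H = Graph H
    module L = Layout L
    module L′ = Layout L′

    σ : Fin H.order → Fin G.order
    σ = proj₁ ∘ diagonal L L′ T T′
    σ-eq : ∀ i → L′.pos (i , i) ≡ L.pos (σ i , σ i)
    σ-eq = proj₂ ∘ diagonal L L′ T T′
    τ : Fin G.order → Fin H.order
    τ = proj₁ ∘ diagonal L′ L T′ T
    τ-eq : ∀ k → L.pos (k , k) ≡ L′.pos (τ k , τ k)
    τ-eq = proj₂ ∘ diagonal L′ L T′ T

    στ : ∀ k → σ (τ k) ≡ k
    στ k = cong proj₁ (L.pos-inj (trans (sym (σ-eq (τ k))) (sym (τ-eq k))))
    τσ : ∀ i → τ (σ i) ≡ i
    τσ i = cong proj₁ (L′.pos-inj (trans (sym (τ-eq (σ i))) (sym (σ-eq i))))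

  codes : Graph × Graph → CodePair F
  codes (G , H) = codePair (length² G H) (graphCode (layout₁ G H)) (graphCode (layout₂ G H))

  -- After the column permutation the two bases differ only in the order given by σ, so combinations
  -- correspond by reindexing their coefficients.
  ≅⇒Equivalent : ∀ {G H N} (L : Layout G (Fin N)) (L′ : Layout H (Fin N))
    (σ : Permutation (Graph.order G) (Graph.order H)) (π : Permutation′ N) →
    (∀ p w → Layout.column L (π ⟨$⟩ʳ p) w ≡ Layout.column L′ p (σ ⟨$⟩ʳ w)) →
    Equivalent F (graphCode L) (graphCode L′)
  ≅⇒Equivalent L L′ σ π eq = π , λ v → mk⇔
    (λ (u , (a , u≈) , v≈) → a ∘ (σ ⟨$⟩ˡ_) , λ j →
      ≈-trans (v≈ j) (≈-trans (u≈ (π ⟨$⟩ʳ j))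
        (reindex (λ w → ≈-reflexive (cong a (sym (inverseˡ σ)))) j)))
    (λ (a , v≈) → combination F (a ∘ (σ ⟨$⟩ʳ_)) (Code.basis (graphCode L)) ,
      (a ∘ (σ ⟨$⟩ʳ_) , λ _ → ≈-refl) , λ j → ≈-trans (v≈ j) (≈-sym (reindex (λ _ → ≈-refl) j)))
    where
    reindex : ∀ {a a′} → (∀ w → a w ≈ a′ (σ ⟨$⟩ʳ w)) → ∀ j →
              combination F a (Code.basis (graphCode L)) (π ⟨$⟩ʳ j) ≈
              combination F a′ (Code.basis (graphCode L′)) j
    reindex {a} {a′} a≈ j = begin
      sum (λ w → a w F.* ι (Layout.column L (π ⟨$⟩ʳ j) w))
        ≈⟨ sum-cong-≋ (λ w → *-cong (a≈ w) (ι-cong (eq j w))) ⟩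
      sum (λ w → a′ (σ ⟨$⟩ʳ w) F.* ι (Layout.column L′ j (σ ⟨$⟩ʳ w)))
        ≈⟨ sum-permute (λ v → a′ v F.* ι (Layout.column L′ j v)) σ ⟨
      sum (λ v → a′ v F.* ι (Layout.column L′ j v)) ∎

  basis∈ : ∀ {n} (C : Code F n) i → _∈ᶜ_ F (Code.basis C i) C
  basis∈ C i = a , λ j → begin
    Code.basis C i j
      ≈⟨ sum-indicator (λ k → Code.basis C k j) (mark (toℕ i)) i (mark-refl i) mark-≢ ⟨
    sum (λ k → Code.basis C k j F.* a k)
      ≈⟨ sum-cong-≋ (λ k → *-comm (Code.basis C k j) (a k)) ⟩
    sum (λ k → a k F.* Code.basis C k j) ∎
    where
    a : Fin (Code.dimension C) → Carrier
    a k = ι (mark (toℕ i) k)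

  -- Up to the permutation π of the columns, every basis vector of either code is a combination of
  -- the other basis. Read column by column, the coefficients are the matrices of the two linear
  -- maps.
  Equivalent⇒≅ : ∀ {G H N} (L : Layout G (Fin N)) (L′ : Layout H (Fin N)) →
                 Equivalent F (graphCode L) (graphCode L′) → G ≅ H
  Equivalent⇒≅ {G} {H} L L′ (π , equiv) = transforms⇒≅ (permuteLayout π L) L′
    ((λ v → proj₁ (backward v)) , λ p v → proj₂ (backward v) p)
    ((λ w → proj₁ (forward w)) , λ p w → proj₂ (forward w) p)
    where
    open Layout L using () renaming (column to x)
    open Layout L′ using () renaming (column to y)

    forward : ∀ w → _∈ᶜ_ F (λ p → ι (x (π ⟨$⟩ʳ p) w)) (graphCode L′)
    forward w = Equivalence.to (equiv _) (_ , basis∈ (graphCode L) w , λ _ → ≈-refl)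

    backward : ∀ v → ∃[ a ] ∀ p → ι (y p v) ≈ sum (λ w → a w F.* ι (x (π ⟨$⟩ʳ p) w))
    backward v with u , (a , u≈) , v≈ ← Equivalence.from (equiv _) (basis∈ (graphCode L′) v)
      = a , λ p → ≈-trans (v≈ p) (u≈ (π ⟨$⟩ʳ p))

  encode-codes : ∀ G H → Problem.encode (CodeEquivalence F) (codes (G , H)) ≡
                         output-word ι (Graph.adjacent G) (Graph.adjacent H)
  encode-codes G H = cong₂
    (λ u v → letters (length² G H) ++ (letters G.order ++ u) ++ letters H.order ++ v)
    (trans (map-rowMajor inj₂ (Code.basis (graphCode (layout₁ G H))))
      (cong List.concat (tabulate-cong λ v → tabulate-blocks G.order {H.order}
        (λ i j → cong (inj₂ ∘ ι) (Layout.column-at (layout₁ G H) (i , j) v))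
        -- In the foreign block the printed majority has two values `false` and reduces to `false`,
        -- as the zero column does.
        (λ i j → cong (λ s → inj₂ (ι (extendByZero (incidence G) s v)))
          (Inverse.strictlyInverseˡ (position {G.order}) (inj₂ (i , j)))))))
    (trans (map-rowMajor inj₂ (Code.basis (graphCode (layout₂ G H))))
      (cong List.concat (tabulate-cong λ v → tabulate-blocks G.order {H.order}
        (λ i j → cong (λ s → inj₂ (ι (extendByZero (incidence H) (Sum.swap s) v)))
          (Inverse.strictlyInverseˡ (position {G.order}) (inj₁ (i , j))))
        (λ i j → cong (inj₂ ∘ ι) (Layout.column-at (layout₂ G H) (i , j) v)))))
    where
    module G = Graph G
    module H = Graph H
    letters : ℕ → List (Bool ⊎ Carrier)
    letters = unary-letters ι G.adjacent H.adjacent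

lemma2p4 : ∀ {c ℓ} (F : Field c ℓ) → GraphIsomorphism ≤ₚ CodeEquivalence F
lemma2p4 F = record
  { reduce         = codes F
  ; correct        = λ (G , H) → mk⇔
      (λ (σ , σ-adj) → ≅⇒Equivalent F (layout₁ G H) (layout₂ G H) σ
        (exchangeColumns G H σ σ-adj) (column-exchange G H σ σ-adj))
      (Equivalent⇒≅ F (layout₁ G H) (layout₂ G H))
  ; polynomialTime = program-polynomialTime
      (Problem.encode GraphIsomorphism) (Problem.encode (CodeEquivalence F)) (codes F)
      (reduction (ι F))
      λ (G , H) → _ , output-≡ _ (sym (encode-codes F G H))
        (reduction-runs (ι F) (Graph.adjacent G) (Graph.adjacent H))
  }
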